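{- Let $n$ and $k$ be positive integers and let $p$ be a prime such that $p^2 \mid k$. If there exists a matrix $H \in \mathrm{BH}(n,k)$, then there exists a matrix $H' \in \mathrm{BH}(np, k/p)$.
   Context: For positive integers $n,k$, $\mathrm{BH}(n,k)$ denotes the set of $n\times n$ Butson-Hadamard matrices: $n \times n$ complex matrices $H$ all of whose entries are complex $k^{\text{th}}$ roots of unity and which satisfy $HH^* = nI_n$, where $H^*$ is the conjugate transpose of $H$ and $I_n$ is the $n\times n$ identity matrix. -}

module Defs where

open import Level using (Level; _⊔_)
open import Algebra.Bundles using (CommutativeRing)
open import Data.Nat using (ℕ; zero; suc; _<_)
open import Data.Fin using (Fin; zero; suc)
open import Data.Product using (_×_; ∃)
open import Data.Sum using (_⊎_)
open import Relation.Binary.PropositionalEquality using (_≡_)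
open import Relation.Nullary using (¬_; Dec; yes; no)
open import Data.Fin using (_≟_)

-- Generic setting replacing ℂ: a commutative ring R, used only when it is a
-- characteristic-zero integral domain containing a primitive k-th root of unity.
module _ {c ℓ : Level} (R : CommutativeRing c ℓ) where
  open CommutativeRing R hiding (zero)

  pow : Carrier → ℕ → Carrier
  pow x zero    = 1#
  pow x (suc m) = x * pow x m

  natR : ℕ → Carrier
  natR zero    = 0#
  natR (suc m) = 1# + natR m

  sumFin : (n : ℕ) → (Fin n → Carrier) → Carrier
  sumFin zero    f = 0#
  sumFin (suc n) f = f zero + sumFin n (λ l → f (suc l))

  IsIntegralDomain : Set (c ⊔ ℓ)
  IsIntegralDomain = ∀ x y → x * y ≈ 0# → (x ≈ 0#) ⊎ (y ≈ 0#)

  CharZero : Set ℓ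
  CharZero = ∀ m → ¬ (natR (suc m) ≈ 0#)

  IsPrimitiveRoot : ℕ → Carrier → Set ℓ
  IsPrimitiveRoot k ζ = pow ζ k ≈ 1# × (∀ d → 0 < d → d < k → ¬ (pow ζ d ≈ 1#))

  IsRootOfUnity : ℕ → Carrier → Set ℓ
  IsRootOfUnity k x = pow x k ≈ 1#

  -- complex conjugate of a k-th root of unity x: conj x = x⁻¹ = x^(k-1)
  conjRoot : ℕ → Carrier → Carrier
  conjRoot zero    x = 1#
  conjRoot (suc k) x = pow x k

  scaledId : (n : ℕ) → Fin n → Fin n → Carrier
  scaledId n i j with i ≟ j
  ... | yes _ = natR n
  ... | no  _ = 0#

  IsBH : (n k : ℕ) → (Fin n → Fin n → Carrier) → Set ℓ
  IsBH n k H =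
    (∀ i j → IsRootOfUnity k (H i j)) ×
    (∀ i j → sumFin n (λ l → H i l * conjRoot k (H j l)) ≈ scaledId n i j)

  BHExists : (n k : ℕ) → Set (c ⊔ ℓ)
  BHExists n k = ∃ λ (H : Fin n → Fin n → Carrier) → IsBH n k H

{-# OPTIONS --safe #-}

{-
Write the entries of H as powers ζ^a(i,j) and put m = k/p. The entry of H' in row (i,s) and
column (j,t) is ζ^(p ⌊A/p⌋ + m t A) with A = a(i,j) + s: it is a power of ζ^p, and it is the
A-th power of the conjugate ζ^(1 + m t), up to the factor ζ^(A mod p). Summing over t, the inner
product of two rows becomes a combination of the sums Σ_j (ζ^(1 + m t))^(a(i,j) - a(i',j)), which
are conjugate to the inner products of the rows of H and hence equal to n or 0.

The conjugation needs, for a prime l not dividing k, that p(ζ) = 0 implies p(ζ^l) = 0 for an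
integer polynomial p. Equality in R is not decidable, so there is no minimal polynomial; instead
a gcd g of p and x^k - 1 is computed over ℤ, with g h = N x^e (x^k - 1), and l ∤ N after
applying Gauss' lemma at l. As R is a domain, g(ζ^l) = 0 or h(ζ^l) = 0. The second case is
impossible: h(ζ)^l would be divisible by l in ℤ[ζ], while g'(ζ) h(ζ) = N k ζ^j for some j, so
l would divide (N k)^l in ℤ[ζ], which Gaussian elimination modulo l excludes.
-}

module Submission where

open import Defs
open import Level using (Level; _⊔_)
open import Algebra.Bundles using (CommutativeRing)
open import Algebra.Solver.Ring.AlmostCommutativeRing
  using (fromCommutativeRing; -raw-almostCommutative⟶; _-Raw-AlmostCommutative⟶_)
import Algebra.Solver.Ring as RingSolver
open import Data.Fin as Fin using (Fin; zero; suc; toℕ; fromℕ; inject₁; combine; remQuot; _↑ˡ_; _↑ʳ_)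
import Data.Fin.Properties as Fin
open import Data.Integer as ℤ using (ℤ; +_; -[1+_]; 0ℤ; 1ℤ; -1ℤ) renaming (∣_∣ to abs)
import Data.Integer.Divisibility.Signed as ℤ
import Data.Integer.Properties as ℤ
open import Data.List using (List; []; _∷_; map; length)
open import Data.List.Properties using (length-map)
open import Data.List.Relation.Unary.All using (All; []; _∷_)
open import Data.Maybe using (Maybe; just; nothing)
open import Data.Nat as ℕ using (ℕ; zero; suc; s≤s; z≤n; _!)
open import Data.Nat.Combinatorics using (_C_; nCn≡1; nCk≡nC[n∸k]; nCk≡n!/k![n-k]!; k![n∸k]!∣n!)
import Data.Nat.Divisibility as ℕ
open import Data.Nat.DivMod
  using (m≡m%n+[m/n]*n; m%n<n; m<n⇒m%n≡m; %-remove-+ˡ; %-remove-+ʳ; m*n/n≡m; m/n*n≡m)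
open import Data.Nat.ListAction using (product)
open import Data.Nat.Primality using (Prime; euclidsLemma; prime⇒nonZero; prime⇒nonTrivial)
open import Data.Nat.Primality.Factorisation using (PrimeFactorisation; factorise)
import Data.Nat.Properties as ℕ
open import Data.Nat.Tactic.RingSolver using (solve-∀)
open import Data.Product using (∃; _×_; _,_; proj₁; proj₂)
open import Data.Sum using (_⊎_; inj₁; inj₂; [_,_]′)
open import Function using (_∘_)
open import Relation.Binary.PropositionalEquality as ≡ using (_≡_; _≢_; cong; cong₂)
open import Relation.Nullary using (yes; no; contradiction; ¬_)

-- As p divides m and k = m p, the maps ζ ↦ ζ^(1 + m t) with t < p fix ζ^p: they are the Galois
-- group of ℚ(ζ) over ℚ(ζ^p), an extension of degree p with basis 1, ζ, ..., ζ^(p-1). The column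
-- index t runs through this group, the shift by s through this basis. Dropping ζ^(A mod p) moves
-- every entry among the powers of ζ^p. It does no harm: where two rows have exponents A that differ
-- modulo p, the sum over t is 0 with or without the dropped factors, and elsewhere these factors
-- cancel.
--
-- No automorphism of R is at hand, so conjugation is a statement about zeros of integer
-- polynomials. Coefficient lists may end in zeros, so identities between them are proved for their
-- values at positive integers, where the ring solver applies. The coefficients are then recovered
-- from the values, and the identity holds for values and derivatives in any ring. Case distinctions
-- on elements of R come from the domain property, which decides which factor of a vanishing product
-- is 0.

ℤ-ring : CommutativeRing _ _
ℤ-ring = ℤ.+-*-commutativeRing

-- Integer polynomials, constant term first, with values and derivatives in a ring

Poly : Set
Poly = List ℤ

infixl 6 _⊕_
infixl 7 _⊗_
infixr 8 _·_

_⊕_ : Poly → Poly → Poly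
[]      ⊕ q       = q
(a ∷ p) ⊕ []      = a ∷ p
(a ∷ p) ⊕ (b ∷ q) = (a ℤ.+ b) ∷ (p ⊕ q)

_·_ : ℤ → Poly → Poly
a · p = map (a ℤ.*_) p

_⊗_ : Poly → Poly → Poly
[]      ⊗ q = []
(a ∷ p) ⊗ q = a · q ⊕ (0ℤ ∷ p ⊗ q)

X^ : ℕ → Poly
X^ zero    = 1ℤ ∷ []
X^ (suc e) = 0ℤ ∷ X^ e

Hom : ∀ {c ℓ} → CommutativeRing c ℓ → Set _
Hom R = CommutativeRing.rawRing ℤ-ring -Raw-AlmostCommutative⟶ fromCommutativeRing R

module Evaluation {c ℓ} (R : CommutativeRing c ℓ) (hom : Hom R) where
  open CommutativeRing R hiding (zero)
  open _-Raw-AlmostCommutative⟶_ hom public renaming (⟦_⟧ to ι)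
  open import Algebra.Properties.Semiring.Exp semiring using (_^_)
  open import Relation.Binary.Reasoning.Setoid setoid

  ι-≟ : ∀ a b → Maybe (ι a ≈ ι b)
  ι-≟ a b with a ℤ.≟ b
  ... | yes ≡.refl = just refl
  ... | no _       = nothing

  open RingSolver (CommutativeRing.rawRing ℤ-ring) (fromCommutativeRing R) hom ι-≟ public
    using (solve; _:=_; _:+_; _:*_; _:-_; :-_; con)


  1^ : ∀ n → 1# ^ n ≈ 1#
  1^ zero    = refl
  1^ (suc n) = trans (*-identityˡ _) (1^ n)

  ev : Poly → Carrier → Carrier
  ev []      x = 0#
  ev (a ∷ p) x = ι a + x * ev p x

  -- The value of the formal derivative, by the product rule (a + x p)′ = p + x p′; no index enters
  -- as a coefficient.
  d : Poly → Carrier → Carrier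
  d []      x = 0#
  d (a ∷ p) x = ev p x + x * d p x

  ev-cong : ∀ p {x y} → x ≈ y → ev p x ≈ ev p y
  ev-cong []      x≈y = refl
  ev-cong (a ∷ p) x≈y = +-congˡ (*-cong x≈y (ev-cong p x≈y))

  ev-⊕ : ∀ p q x → ev (p ⊕ q) x ≈ ev p x + ev q x
  ev-⊕ []      q       x = sym (+-identityˡ _)
  ev-⊕ (a ∷ p) []      x = sym (+-identityʳ _)
  ev-⊕ (a ∷ p) (b ∷ q) x = begin
    ι (a ℤ.+ b) + x * ev (p ⊕ q) x
      ≈⟨ +-cong (+-homo a b) (*-congˡ (ev-⊕ p q x)) ⟩
    (ι a + ι b) + x * (ev p x + ev q x)
      ≈⟨ solve 5 (λ a b x p q → (a :+ b) :+ x :* (p :+ q) := (a :+ x :* p) :+ (b :+ x :* q))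
           refl (ι a) (ι b) x (ev p x) (ev q x) ⟩
    (ι a + x * ev p x) + (ι b + x * ev q x) ∎

  ev-· : ∀ a p x → ev (a · p) x ≈ ι a * ev p x
  ev-· a []      x = sym (zeroʳ _)
  ev-· a (b ∷ p) x = begin
    ι (a ℤ.* b) + x * ev (a · p) x ≈⟨ +-cong (*-homo a b) (*-congˡ (ev-· a p x)) ⟩
    ι a * ι b + x * (ι a * ev p x)
      ≈⟨ solve 4 (λ a b x p → a :* b :+ x :* (a :* p) := a :* (b :+ x :* p))
           refl (ι a) (ι b) x (ev p x) ⟩
    ι a * (ι b + x * ev p x) ∎

  ev-shift : ∀ p x → ev (0ℤ ∷ p) x ≈ x * ev p x
  ev-shift p x = trans (+-congʳ 0-homo) (+-identityˡ _)

  ev-⊗ : ∀ p q x → ev (p ⊗ q) x ≈ ev p x * ev q x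
  ev-⊗ []      q x = sym (zeroˡ _)
  ev-⊗ (a ∷ p) q x = begin
    ev (a · q ⊕ (0ℤ ∷ p ⊗ q)) x          ≈⟨ ev-⊕ (a · q) _ x ⟩
    ev (a · q) x + ev (0ℤ ∷ p ⊗ q) x     ≈⟨ +-cong (ev-· a q x) (ev-shift (p ⊗ q) x) ⟩
    ι a * ev q x + x * ev (p ⊗ q) x      ≈⟨ +-congˡ (*-congˡ (ev-⊗ p q x)) ⟩
    ι a * ev q x + x * (ev p x * ev q x)
      ≈⟨ solve 4 (λ a x p q → a :* q :+ x :* (p :* q) := (a :+ x :* p) :* q)
           refl (ι a) x (ev p x) (ev q x) ⟩
    (ι a + x * ev p x) * ev q x          ∎

  ev-X^ : ∀ e x → ev (X^ e) x ≈ x ^ e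
  ev-X^ zero    x = trans (+-cong 1-homo (zeroʳ x)) (+-identityʳ _)
  ev-X^ (suc e) x = trans (ev-shift (X^ e) x) (*-congˡ (ev-X^ e x))

  d-⊕ : ∀ p q x → d (p ⊕ q) x ≈ d p x + d q x
  d-⊕ []      q       x = sym (+-identityˡ _)
  d-⊕ (a ∷ p) []      x = sym (+-identityʳ _)
  d-⊕ (a ∷ p) (b ∷ q) x = begin
    ev (p ⊕ q) x + x * d (p ⊕ q) x ≈⟨ +-cong (ev-⊕ p q x) (*-congˡ (d-⊕ p q x)) ⟩
    (ev p x + ev q x) + x * (d p x + d q x)
      ≈⟨ solve 5 (λ a b x p q → (a :+ b) :+ x :* (p :+ q) := (a :+ x :* p) :+ (b :+ x :* q))
           refl (ev p x) (ev q x) x (d p x) (d q x) ⟩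
    (ev p x + x * d p x) + (ev q x + x * d q x) ∎

  d-· : ∀ a p x → d (a · p) x ≈ ι a * d p x
  d-· a []      x = sym (zeroʳ _)
  d-· a (b ∷ p) x = begin
    ev (a · p) x + x * d (a · p) x ≈⟨ +-cong (ev-· a p x) (*-congˡ (d-· a p x)) ⟩
    ι a * ev p x + x * (ι a * d p x)
      ≈⟨ solve 4 (λ a b x p → a :* b :+ x :* (a :* p) := a :* (b :+ x :* p))
           refl (ι a) (ev p x) x (d p x) ⟩
    ι a * (ev p x + x * d p x) ∎

  d-⊗ : ∀ p q x → d (p ⊗ q) x ≈ d p x * ev q x + ev p x * d q x
  d-⊗ []      q x = sym (trans (+-cong (zeroˡ _) (zeroˡ _)) (+-identityˡ _))
  d-⊗ (a ∷ p) q x = begin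
    d (a · q ⊕ (0ℤ ∷ p ⊗ q)) x
      ≈⟨ d-⊕ (a · q) _ x ⟩
    d (a · q) x + (ev (p ⊗ q) x + x * d (p ⊗ q) x)
      ≈⟨ +-cong (d-· a q x) (+-cong (ev-⊗ p q x) (*-congˡ (d-⊗ p q x))) ⟩
    ι a * d q x + (ev p x * ev q x + x * (d p x * ev q x + ev p x * d q x))
      ≈⟨ solve 6 (λ a x p q p′ q′ →
              a :* q′ :+ (p :* q :+ x :* (p′ :* q :+ p :* q′))
           := (p :+ x :* p′) :* q :+ (a :+ x :* p) :* q′)
           refl (ι a) x (ev p x) (ev q x) (d p x) (d q x) ⟩
    (ev p x + x * d p x) * ev q x + (ι a + x * ev p x) * d q x ∎

  ev-zeros : ∀ {p} → All (_≡ 0ℤ) p → ∀ x → ev p x ≈ 0#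
  ev-zeros []            x = refl
  ev-zeros {_ ∷ p} (≡.refl ∷ z) x = trans (ev-shift p x) (trans (*-congˡ (ev-zeros z x)) (zeroʳ x))

  d-zeros : ∀ {p} → All (_≡ 0ℤ) p → ∀ x → d p x ≈ 0#
  d-zeros []      x = refl
  d-zeros (_ ∷ z) x =
    trans (+-cong (ev-zeros z x) (*-congˡ (d-zeros z x))) (trans (+-identityˡ _) (zeroʳ x))

  -- The extra factor `x` avoids the exponent e - 1.
  d-X^ : ∀ e x → x * d (X^ e) x ≈ ι (+ e) * x ^ e
  d-X^ zero    x = begin
    x * (0# + x * 0#) ≈⟨ *-congˡ (trans (+-identityˡ _) (zeroʳ x)) ⟩
    x * 0#            ≈⟨ zeroʳ x ⟩
    0#                ≈⟨ zeroˡ 1# ⟨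
    0# * 1#           ≈⟨ *-congʳ 0-homo ⟨
    ι 0ℤ * 1#         ∎
  d-X^ (suc e) x = begin
    x * (ev (X^ e) x + x * d (X^ e) x) ≈⟨ *-congˡ (+-cong (ev-X^ e x) (d-X^ e x)) ⟩
    x * (x ^ e + ι (+ e) * x ^ e)
      ≈⟨ solve 3 (λ x y i → x :* (y :+ i :* y) := (con 1ℤ :+ i) :* (x :* y)) refl x (x ^ e) (ι (+ e)) ⟩
    (ι 1ℤ + ι (+ e)) * (x * x ^ e)     ≈⟨ *-congʳ (+-homo 1ℤ (+ e)) ⟨
    ι (+ suc e) * (x * x ^ e)          ∎

-- Values at positive integers and Gauss' lemma

module ℤ-Eval = Evaluation ℤ-ring (-raw-almostCommutative⟶ (fromCommutativeRing ℤ-ring))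

-- Evaluation at the positive integers only, so that a factor x can be cancelled.
at : Poly → ℕ → ℤ
at p n = ℤ-Eval.ev p (+ suc n)

infix 4 _≃_

_≃_ : Poly → Poly → Set
p ≃ q = ∀ n → at p n ≡ at q n

module _ where
  open ℤ-Eval using (solve; _:=_; _:+_; _:*_; :-_; con; ev-⊕; ev-·)
  open ≡.≡-Reasoning

  -- A nonzero integer has no multiple of something larger than itself as its value. This is the
  -- device that reads a constant term off the values of a polynomial.
  i≡[1+∣i∣]*j⇒i≡0 : ∀ i j → i ≡ + suc (abs i) ℤ.* j → i ≡ 0ℤ
  i≡[1+∣i∣]*j⇒i≡0 i j eq with (abs i) in ∣i∣≡
  ... | zero  = ℤ.∣i∣≡0⇒i≡0 ∣i∣≡
  ... | suc m = contradiction (ℕ.∣⇒≤ (ℕ.divides (abs j) m≡)) ℕ.1+n≰n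
    where
    m≡ : suc m ≡ (abs j) ℕ.* suc (suc m)
    m≡ = ≡.trans (≡.sym ∣i∣≡) (≡.trans (cong abs eq)
           (≡.trans (ℤ.abs-* (+ suc (suc m)) j) (ℕ.*-comm (suc (suc m)) (abs j))))

  -- At x = 1 + |a| the constant term `a` is a multiple of x, hence 0 by size; afterwards x can be
  -- cancelled at every positive point. The index `abs a` denotes this x, because `at` evaluates at
  -- the successor.
  ≃[]⇒zeros : ∀ p → p ≃ [] → All (_≡ 0ℤ) p
  ≃[]⇒zeros []      p≃[] = []
  ≃[]⇒zeros (a ∷ p) p≃[] = a≡0 ∷ ≃[]⇒zeros p λ n → ℤ.*-cancelˡ-≡ (+ suc n) _ _ (begin
      + suc n ℤ.* at p n        ≡⟨ ℤ.+-identityˡ _ ⟨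
      0ℤ ℤ.+ + suc n ℤ.* at p n ≡⟨ cong (ℤ._+ _) a≡0 ⟨
      at (a ∷ p) n              ≡⟨ p≃[] n ⟩
      0ℤ                        ≡⟨ ℤ.*-zeroʳ (+ suc n) ⟨
      + suc n ℤ.* 0ℤ            ∎)
    where
    a≡0 : a ≡ 0ℤ
    a≡0 = i≡[1+∣i∣]*j⇒i≡0 a (ℤ.- at p (abs a)) (begin
      a
        ≡⟨ solve 3 (λ a x p → a := (a :+ x :* p) :+ x :* (:- p)) ≡.refl a (+ suc (abs a))
            (at p (abs a)) ⟩
      at (a ∷ p) (abs a) ℤ.+ + suc (abs a) ℤ.* (ℤ.- at p (abs a))
        ≡⟨ cong (ℤ._+ + suc (abs a) ℤ.* (ℤ.- at p (abs a))) (p≃[] (abs a)) ⟩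
      0ℤ ℤ.+ + suc (abs a) ℤ.* (ℤ.- at p (abs a))
        ≡⟨ ℤ.+-identityˡ _ ⟩
      + suc (abs a) ℤ.* (ℤ.- at p (abs a)) ∎)

  ≃⇒zeros : ∀ p q → p ≃ q → All (_≡ 0ℤ) (p ⊕ -1ℤ · q)
  ≃⇒zeros p q p≃q = ≃[]⇒zeros _ λ n → begin
    at (p ⊕ -1ℤ · q) n         ≡⟨ ev-⊕ p (-1ℤ · q) (+ suc n) ⟩
    at p n ℤ.+ at (-1ℤ · q) n  ≡⟨ cong₂ ℤ._+_ (p≃q n) (ev-· -1ℤ q (+ suc n)) ⟩
    at q n ℤ.+ -1ℤ ℤ.* at q n  ≡⟨ solve 1 (λ q → q :+ con -1ℤ :* q := con 0ℤ) ≡.refl (at q n) ⟩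
    0ℤ                         ∎

  module _ {l : ℕ} (l-prime : Prime l) where
    private instance _ = prime⇒nonZero l-prime

    prime∣*⇒ : ∀ i j k → i ℤ.* j ≡ + l ℤ.* k → (+ l ℤ.∣ i) ⊎ (+ l ℤ.∣ j)
    prime∣*⇒ i j k eq = [ (λ x → inj₁ (ℤ.∣ᵤ⇒∣ x)) , (λ x → inj₂ (ℤ.∣ᵤ⇒∣ x)) ]′
      (euclidsLemma (abs i) (abs j) l-prime (≡.subst (l ℕ.∣_) (ℤ.abs-* i j)
        (ℤ.∣⇒∣ᵤ (ℤ.divides k (≡.trans eq (ℤ.*-comm (+ l) k))))))

    -- With b the constant term and w the tail of `v`, l b = x (f - l w) at every positive x. The
    -- choice x = 1 + |l b| forces b = 0, so `v` is x times its tail.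
    unshift : ∀ (f : ℕ → ℤ) v → (∀ n → + suc n ℤ.* f n ≡ + l ℤ.* at v n) →
              ∃ λ w → ∀ n → f n ≡ + l ℤ.* at w n
    unshift f []      eq = [] , λ n → ℤ.*-cancelˡ-≡ (+ suc n) _ _
      (≡.trans (eq n) (solve 2 (λ x l → l :* con 0ℤ := x :* (l :* con 0ℤ)) ≡.refl (+ suc n) (+ l)))
    unshift f (b ∷ w) eq = w , λ n → ℤ.*-cancelˡ-≡ (+ suc n) _ _ (begin
      + suc n ℤ.* f n                          ≡⟨ eq n ⟩
      + l ℤ.* (b ℤ.+ + suc n ℤ.* at w n)       ≡⟨ cong (λ b → + l ℤ.* (b ℤ.+ + suc n ℤ.* at w n)) b≡0 ⟩
      + l ℤ.* (0ℤ ℤ.+ + suc n ℤ.* at w n)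
        ≡⟨ solve 3 (λ l x w → l :* (con 0ℤ :+ x :* w) := x :* (l :* w)) ≡.refl (+ l) (+ suc n) (at w n) ⟩
      + suc n ℤ.* (+ l ℤ.* at w n)             ∎)
      where
      m = abs (+ l ℤ.* b)
      b≡0 : b ≡ 0ℤ
      b≡0 = ℤ.*-cancelˡ-≡ (+ l) b 0ℤ
          (≡.trans (i≡[1+∣i∣]*j⇒i≡0 (+ l ℤ.* b) (f m ℤ.+ ℤ.- (+ l ℤ.* at w m)) (begin
        + l ℤ.* b
          ≡⟨ solve 4 (λ l b x w → l :* b := l :* (b :+ x :* w) :+ x :* (:- (l :* w))) ≡.refl (+ l) b
              (+ suc m) (at w m) ⟩
        + l ℤ.* (b ℤ.+ + suc m ℤ.* at w m) ℤ.+ + suc m ℤ.* (ℤ.- (+ l ℤ.* at w m))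
          ≡⟨ cong (ℤ._+ + suc m ℤ.* (ℤ.- (+ l ℤ.* at w m))) (eq m) ⟨
        + suc m ℤ.* f m ℤ.+ + suc m ℤ.* (ℤ.- (+ l ℤ.* at w m))
          ≡⟨ ℤ.*-distribˡ-+ (+ suc m) (f m) _ ⟨
        + suc m ℤ.* (f m ℤ.+ ℤ.- (+ l ℤ.* at w m)) ∎)) (≡.sym (ℤ.*-zeroʳ (+ l))))

    at-pred-l : ∀ p → ℤ-Eval.ev p (+ l) ≡ at p (ℕ.pred l)
    at-pred-l p = cong (λ n → ℤ-Eval.ev p (+ n)) (≡.sym (ℕ.suc-pred l))

    Factor : Poly → Set
    Factor p = ∃ λ p′ → ∀ n → at p n ≡ + l ℤ.* at p′ n

    GaussAt : Poly → Poly → Set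
    GaussAt g h = ∀ w → (∀ n → at g n ℤ.* at h n ≡ + l ℤ.* at w n) → Factor g ⊎ Factor h

    -- At x = l both factors reduce modulo l to their constant terms, so l divides `a` or `b`. The
    -- divisible term is moved to the right-hand side, x is cancelled, and the induction continues
    -- with a shorter factor.
    gauss : ∀ g h → GaussAt g h
    gauss []          h           w eq = inj₁ ([] , λ _ → ≡.sym (ℤ.*-zeroʳ (+ l)))
    gauss (a ∷ g)     []          w eq = inj₂ ([] , λ _ → ≡.sym (ℤ.*-zeroʳ (+ l)))
    -- The recursive calls are handed over before the quotient is known: `strip` has yet to build
    -- it, and the descent is in the lists alone.
    gauss g₀@(a ∷ g) h₀@(b ∷ h) w eq = [ case-a (gauss g h₀) , case-b (gauss g₀ h) ]′
        (prime∣*⇒ a b _ l∣ab)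
      where
      G H : ℤ
      G = ℤ-Eval.ev g (+ l)
      H = ℤ-Eval.ev h (+ l)

      eq-l : (a ℤ.+ + l ℤ.* G) ℤ.* (b ℤ.+ + l ℤ.* H) ≡ + l ℤ.* ℤ-Eval.ev w (+ l)
      eq-l = ≡.trans (cong₂ ℤ._*_ (at-pred-l (a ∷ g)) (at-pred-l (b ∷ h)))
               (≡.trans (eq (ℕ.pred l)) (cong (+ l ℤ.*_) (≡.sym (at-pred-l w))))

      l∣ab : a ℤ.* b ≡ + l ℤ.* (ℤ-Eval.ev w (+ l) ℤ.+ ℤ.- (a ℤ.* H ℤ.+ G ℤ.* (b ℤ.+ + l ℤ.* H)))
      l∣ab = begin
        a ℤ.* b
          ≡⟨ solve 5 (λ a b l G H →
               a :* b := (a :+ l :* G) :* (b :+ l :* H) :+ l :* (:- (a :* H :+ G :* (b :+ l :* H))))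
               ≡.refl a b (+ l) G H ⟩
        (a ℤ.+ + l ℤ.* G) ℤ.* (b ℤ.+ + l ℤ.* H) ℤ.+ + l ℤ.* (ℤ.- (a ℤ.* H ℤ.+ G ℤ.* (b ℤ.+ + l ℤ.* H)))
          ≡⟨ cong (ℤ._+ + l ℤ.* (ℤ.- (a ℤ.* H ℤ.+ G ℤ.* (b ℤ.+ + l ℤ.* H)))) eq-l ⟩
        + l ℤ.* ℤ-Eval.ev w (+ l) ℤ.+ + l ℤ.* (ℤ.- (a ℤ.* H ℤ.+ G ℤ.* (b ℤ.+ + l ℤ.* H)))
          ≡⟨ ℤ.*-distribˡ-+ (+ l) _ _ ⟨
        + l ℤ.* (ℤ-Eval.ev w (+ l) ℤ.+ ℤ.- (a ℤ.* H ℤ.+ G ℤ.* (b ℤ.+ + l ℤ.* H))) ∎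

      strip : ∀ a′ {a} p q → a ≡ a′ ℤ.* + l →
          (∀ n → (a ℤ.+ + suc n ℤ.* at p n) ℤ.* at q n ≡ + l ℤ.* at w n) →
              ∃ λ v → ∀ n → at p n ℤ.* at q n ≡ + l ℤ.* at v n
      strip a′ {a} p q a≡ eq = unshift _ (w ⊕ (ℤ.- a′) · q) λ n → begin
        + suc n ℤ.* (at p n ℤ.* at q n)
          ≡⟨ solve 5 (λ x p q a l → x :* (p :* q) := (a :* l :+ x :* p) :* q :+ l :* ((:- a) :* q))
               ≡.refl (+ suc n) (at p n) (at q n) a′ (+ l) ⟩
        (a′ ℤ.* + l ℤ.+ + suc n ℤ.* at p n) ℤ.* at q n ℤ.+ + l ℤ.* ((ℤ.- a′) ℤ.* at q n)
          ≡⟨ cong (λ a → (a ℤ.+ + suc n ℤ.* at p n) ℤ.* at q n ℤ.+ + l ℤ.* ((ℤ.- a′) ℤ.* at q n)) a≡ ⟨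
        (a ℤ.+ + suc n ℤ.* at p n) ℤ.* at q n ℤ.+ + l ℤ.* ((ℤ.- a′) ℤ.* at q n)
          ≡⟨ cong₂ (λ s t → s ℤ.+ + l ℤ.* t) (eq n) (≡.sym (ev-· (ℤ.- a′) q (+ suc n))) ⟩
        + l ℤ.* at w n ℤ.+ + l ℤ.* at ((ℤ.- a′) · q) n
          ≡⟨ ℤ.*-distribˡ-+ (+ l) _ _ ⟨
        + l ℤ.* (at w n ℤ.+ at ((ℤ.- a′) · q) n)
          ≡⟨ cong (+ l ℤ.*_) (ev-⊕ w ((ℤ.- a′) · q) (+ suc n)) ⟨
        + l ℤ.* at (w ⊕ (ℤ.- a′) · q) n ∎

      attach : ∀ {a} a′ p → a ≡ a′ ℤ.* + l → Factor p → Factor (a ∷ p)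
      attach a′ p a≡ (p′ , p≡) = a′ ∷ p′ , λ n →
        ≡.trans (cong₂ (λ a p → a ℤ.+ + suc n ℤ.* p) a≡ (p≡ n))
          (solve 4 (λ a l x p → a :* l :+ x :* (l :* p) := l :* (a :+ x :* p))
             ≡.refl a′ (+ l) (+ suc n) (at p′ n))

      case-a : GaussAt g h₀ → + l ℤ.∣ a → Factor g₀ ⊎ Factor h₀
      case-a rec (ℤ.divides a′ a≡) = [ (λ g∣ → inj₁ (attach a′ g a≡ g∣)) , inj₂ ]′
        (rec (proj₁ r) (proj₂ r))
        where r = strip a′ g (b ∷ h) a≡ eq

      case-b : GaussAt g₀ h → + l ℤ.∣ b → Factor g₀ ⊎ Factor h₀
      case-b rec (ℤ.divides b′ b≡) = [ inj₁ , (λ h∣ → inj₂ (attach b′ h b≡ h∣)) ]′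
        (rec (proj₁ r) (λ n → ≡.trans (ℤ.*-comm (at (a ∷ g) n) (at h n)) (proj₂ r n)))
        where r = strip b′ h (a ∷ g) b≡ λ n → ≡.trans (ℤ.*-comm (at (b ∷ h) n) (at (a ∷ g) n)) (eq n)

-- Divisibility of integer polynomials and elimination of constant terms

open import Algebra.Properties.Semiring.Exp (CommutativeRing.semiring ℤ-ring)
  using () renaming (_^_ to _^ᶻ_; ^-homo-* to ^ᶻ-homo-*)

-- Divisibility up to the factors N x^e, which are invertible at a root of unity.
infix 4 _∥_
record _∥_ (g a : Poly) : Set where
  constructor divides
  field
    scale    : ℤ
    scale≢0  : scale ≢ 0ℤ
    shift    : ℕ
    cofactor : Poly
    equality : ∀ n → scale ℤ.* (+ suc n) ^ᶻ shift ℤ.* at a n ≡ at g n ℤ.* at cofactor n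

*-≢0 : ∀ {i j} → i ≢ 0ℤ → j ≢ 0ℤ → i ℤ.* j ≢ 0ℤ
*-≢0 {i} i≢0 j≢0 ij≡0 = [ i≢0 , j≢0 ]′ (ℤ.i*j≡0⇒i≡0∨j≡0 i ij≡0)

module _ where
  open ℤ-Eval using (solve; _:=_; _:+_; _:*_; :-_; con; ev-⊕; ev-·; ev-⊗; ev-X^; ev-shift)
  open ≡.≡-Reasoning

  ∥-refl : ∀ g → g ∥ g
  ∥-refl g = divides 1ℤ (λ ()) 0 (1ℤ ∷ []) λ n →
    solve 2 (λ x g → con 1ℤ :* con 1ℤ :* g := g :* (con 1ℤ :+ x :* con 0ℤ)) ≡.refl (+ suc n) (at g n)

  ∥-[] : ∀ g → g ∥ []
  ∥-[] g = divides 1ℤ (λ ()) 0 [] λ n →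
    solve 1 (λ g → con 1ℤ :* con 1ℤ :* con 0ℤ := g :* con 0ℤ) ≡.refl (at g n)

  -- This reverses one elimination step: after multiplication by both scales and both powers of x,
  -- `r` and `b` become multiples of `g` together, and `c` joins the scale.
  ∥-combine : ∀ {g a b} c t r → c ≢ 0ℤ → c · a ≃ (0ℤ ∷ r) ⊕ t · b → g ∥ r → g ∥ b → g ∥ a
  ∥-combine {g} {a} {b} c t r c≢0 ca≃xr+tb (divides N N≢0 e q Nr≡gq) (divides M M≢0 f s Mb≡gs) =
    divides (N ℤ.* M ℤ.* c) (*-≢0 (*-≢0 N≢0 M≢0) c≢0) (e ℕ.+ f)
      (M · (X^ f ⊗ (0ℤ ∷ q)) ⊕ (N ℤ.* t) · (X^ e ⊗ s)) λ n →
        let x = + suc n in begin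
      N ℤ.* M ℤ.* c ℤ.* x ^ᶻ (e ℕ.+ f) ℤ.* at a n
        ≡⟨ cong (λ z → N ℤ.* M ℤ.* c ℤ.* z ℤ.* at a n) (^ᶻ-homo-* x e f) ⟩
      N ℤ.* M ℤ.* c ℤ.* (x ^ᶻ e ℤ.* x ^ᶻ f) ℤ.* at a n
        ≡⟨ solve 6 (λ N M c y z a → N :* M :* c :* (y :* z) :* a := N :* M :* (y :* z) :* (c :* a))
             ≡.refl N M c (x ^ᶻ e) (x ^ᶻ f) (at a n) ⟩
      N ℤ.* M ℤ.* (x ^ᶻ e ℤ.* x ^ᶻ f) ℤ.* (c ℤ.* at a n)
        ≡⟨ cong (N ℤ.* M ℤ.* (x ^ᶻ e ℤ.* x ^ᶻ f) ℤ.*_) (ca≡ n) ⟩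
      N ℤ.* M ℤ.* (x ^ᶻ e ℤ.* x ^ᶻ f) ℤ.* (x ℤ.* at r n ℤ.+ t ℤ.* at b n)
        ≡⟨ solve 8 (λ N M y z x r t b →
             N :* M :* (y :* z) :* (x :* r :+ t :* b) :=
             M :* z :* x :* (N :* y :* r) :+ N :* y :* t :* (M :* z :* b))
             ≡.refl N M (x ^ᶻ e) (x ^ᶻ f) x (at r n) t (at b n) ⟩
      M ℤ.* x ^ᶻ f ℤ.* x ℤ.* (N ℤ.* x ^ᶻ e ℤ.* at r n) ℤ.+ N ℤ.* x ^ᶻ e ℤ.* t ℤ.* (M ℤ.* x ^ᶻ f ℤ.* at b n)
        ≡⟨ cong₂ (λ u v → M ℤ.* x ^ᶻ f ℤ.* x ℤ.* u ℤ.+ N ℤ.* x ^ᶻ e ℤ.* t ℤ.* v) (Nr≡gq n) (Mb≡gs n) ⟩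
      M ℤ.* x ^ᶻ f ℤ.* x ℤ.* (at g n ℤ.* at q n) ℤ.+ N ℤ.* x ^ᶻ e ℤ.* t ℤ.* (at g n ℤ.* at s n)
        ≡⟨ solve 9 (λ M z x g q N y t s →
             M :* z :* x :* (g :* q) :+ N :* y :* t :* (g :* s) :=
             g :* (M :* (z :* (x :* q)) :+ N :* t :* (y :* s)))
             ≡.refl M (x ^ᶻ f) x (at g n) (at q n) N (x ^ᶻ e) t (at s n) ⟩
      at g n ℤ.* (M ℤ.* (x ^ᶻ f ℤ.* (x ℤ.* at q n)) ℤ.+ N ℤ.* t ℤ.* (x ^ᶻ e ℤ.* at s n))
        ≡⟨ cong (at g n ℤ.*_) (cofactor≡ n) ⟨
      at g n ℤ.* at (M · (X^ f ⊗ (0ℤ ∷ q)) ⊕ (N ℤ.* t) · (X^ e ⊗ s)) n ∎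
    where
    ca≡ : ∀ n → c ℤ.* at a n ≡ + suc n ℤ.* at r n ℤ.+ t ℤ.* at b n
    ca≡ n = begin
      c ℤ.* at a n                       ≡⟨ ev-· c a (+ suc n) ⟨
      at (c · a) n                       ≡⟨ ca≃xr+tb n ⟩
      at ((0ℤ ∷ r) ⊕ t · b) n            ≡⟨ ev-⊕ (0ℤ ∷ r) (t · b) (+ suc n) ⟩
      at (0ℤ ∷ r) n ℤ.+ at (t · b) n     ≡⟨ cong₂ ℤ._+_ (ev-shift r (+ suc n)) (ev-· t b (+ suc n)) ⟩
      + suc n ℤ.* at r n ℤ.+ t ℤ.* at b n ∎

    cofactor≡ : ∀ n → at (M · (X^ f ⊗ (0ℤ ∷ q)) ⊕ (N ℤ.* t) · (X^ e ⊗ s)) n ≡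
      M ℤ.* ((+ suc n) ^ᶻ f ℤ.* (+ suc n ℤ.* at q n)) ℤ.+ N ℤ.* t ℤ.* ((+ suc n) ^ᶻ e ℤ.* at s n)
    cofactor≡ n = ≡.trans (ev-⊕ (M · (X^ f ⊗ (0ℤ ∷ q))) _ x) (cong₂ ℤ._+_
      (≡.trans (ev-· M (X^ f ⊗ (0ℤ ∷ q)) x) (cong (M ℤ.*_)
        (≡.trans (ev-⊗ (X^ f) (0ℤ ∷ q) x) (cong₂ ℤ._*_ (ev-X^ f x) (ev-shift q x)))))
      (≡.trans (ev-· (N ℤ.* t) (X^ e ⊗ s) x) (cong (N ℤ.* t ℤ.*_)
        (≡.trans (ev-⊗ (X^ e) s x) (cong (ℤ._* at s n) (ev-X^ e x))))))
      where x = + suc n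

  -- The quotient by x of b (a + x p) - a (b + x q), in which the constant terms cancel.
  cross : ℤ → Poly → ℤ → Poly → Poly
  cross a p b q = b · p ⊕ (ℤ.- a) · q

  cross-≃ : ∀ a p b q → b · (a ∷ p) ≃ (0ℤ ∷ cross a p b q) ⊕ a · (b ∷ q)
  cross-≃ a p b q n = begin
    at (b · (a ∷ p)) n               ≡⟨ ev-· b (a ∷ p) x ⟩
    b ℤ.* (a ℤ.+ x ℤ.* at p n)
      ≡⟨ solve 5 (λ a p b q x → b :* (a :+ x :* p) := x :* (b :* p :+ (:- a) :* q) :+ a :* (b :+ x :* q))
           ≡.refl a (at p n) b (at q n) x ⟩
    x ℤ.* (b ℤ.* at p n ℤ.+ (ℤ.- a) ℤ.* at q n) ℤ.+ a ℤ.* (b ℤ.+ x ℤ.* at q n)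
      ≡⟨ cong₂ ℤ._+_
           (≡.trans (ev-shift (cross a p b q) x) (cong (x ℤ.*_)
             (≡.trans (ev-⊕ (b · p) _ x) (cong₂ ℤ._+_ (ev-· b p x) (ev-· (ℤ.- a) q x)))))
           (ev-· a (b ∷ q) x) ⟨
    at (0ℤ ∷ cross a p b q) n ℤ.+ at (a · (b ∷ q)) n
      ≡⟨ ev-⊕ (0ℤ ∷ cross a p b q) (a · (b ∷ q)) x ⟨
    at ((0ℤ ∷ cross a p b q) ⊕ a · (b ∷ q)) n ∎
    where x = + suc n

  0∷-≃ : ∀ p q → 1ℤ · (0ℤ ∷ p) ≃ (0ℤ ∷ p) ⊕ 0ℤ · q
  0∷-≃ p q n = begin
    at (1ℤ · (0ℤ ∷ p)) n              ≡⟨ ev-· 1ℤ (0ℤ ∷ p) (+ suc n) ⟩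
    1ℤ ℤ.* at (0ℤ ∷ p) n
      ≡⟨ solve 2 (λ p q → con 1ℤ :* p := p :+ con 0ℤ :* q) ≡.refl (at (0ℤ ∷ p) n) (at q n) ⟩
    at (0ℤ ∷ p) n ℤ.+ 0ℤ ℤ.* at q n   ≡⟨ cong (λ z → at (0ℤ ∷ p) n ℤ.+ z) (ev-· 0ℤ q (+ suc n)) ⟨
    at (0ℤ ∷ p) n ℤ.+ at (0ℤ · q) n   ≡⟨ ev-⊕ (0ℤ ∷ p) (0ℤ · q) (+ suc n) ⟨
    at ((0ℤ ∷ p) ⊕ 0ℤ · q) n ∎

length-⊕-≤ : ∀ p q {n} → length p ℕ.≤ n → length q ℕ.≤ n → length (p ⊕ q) ℕ.≤ n
length-⊕-≤ []      q       p≤n       q≤n       = q≤n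
length-⊕-≤ (a ∷ p) []      p≤n       q≤n       = p≤n
length-⊕-≤ (a ∷ p) (b ∷ q) (s≤s p≤n) (s≤s q≤n) = s≤s (length-⊕-≤ p q p≤n q≤n)

length-cross-≤ : ∀ a p b q → length q ℕ.≤ length p → length (cross a p b q) ℕ.≤ length p
length-cross-≤ a p b q q≤p = length-⊕-≤ (b · p) _ (ℕ.≤-reflexive (length-map (b ℤ.*_) p))
  (ℕ.≤-trans (ℕ.≤-reflexive (length-map ((ℤ.- a) ℤ.*_) q)) q≤p)

-- From integer values to identities in a ring, and the Euclidean algorithm

module Transfer {c ℓ} (R : CommutativeRing c ℓ) (hom : Hom R) where
  open CommutativeRing R hiding (zero)
  open Evaluation R hom
  open import Relation.Binary.Reasoning.Setoid setoid

  x-y≈0⇒x≈y : ∀ {u v} → u + ι -1ℤ * v ≈ 0# → u ≈ v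
  x-y≈0⇒x≈y {u} {v} eq = begin
    u                     ≈⟨ solve 2 (λ u v → u := (u :+ con -1ℤ :* v) :+ v) refl u v ⟩
    (u + ι -1ℤ * v) + v   ≈⟨ +-congʳ eq ⟩
    0# + v                ≈⟨ +-identityˡ v ⟩
    v                     ∎

  -- The difference has only zero coefficients, so it vanishes at points of any ring.
  ≃⇒ev≈ : ∀ p q → p ≃ q → ∀ x → ev p x ≈ ev q x
  ≃⇒ev≈ p q p≃q x = x-y≈0⇒x≈y (begin
    ev p x + ι -1ℤ * ev q x   ≈⟨ +-congˡ (ev-· -1ℤ q x) ⟨
    ev p x + ev (-1ℤ · q) x   ≈⟨ ev-⊕ p _ x ⟨
    ev (p ⊕ -1ℤ · q) x        ≈⟨ ev-zeros (≃⇒zeros p q p≃q) x ⟩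
    0#                        ∎)

  ≃⇒d≈ : ∀ p q → p ≃ q → ∀ x → d p x ≈ d q x
  ≃⇒d≈ p q p≃q x = x-y≈0⇒x≈y (begin
    d p x + ι -1ℤ * d q x   ≈⟨ +-congˡ (d-· -1ℤ q x) ⟨
    d p x + d (-1ℤ · q) x   ≈⟨ d-⊕ p _ x ⟨
    d (p ⊕ -1ℤ · q) x       ≈⟨ d-zeros (≃⇒zeros p q p≃q) x ⟩
    0#                      ∎)

  module _ (y : Carrier) (y-cancel : ∀ z → y * z ≈ 0# → z ≈ 0#) where

    -- `vanishes` stands in for a Bézout identity. It speaks only of the point `y`, where a factor x
    -- can be cancelled.
    record Gcd (a b : Poly) : Set ℓ where
      constructor mkGcd
      field
        gcd      : Poly
        gcd∥ˡ    : gcd ∥ a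
        gcd∥ʳ    : gcd ∥ b
        vanishes : ev a y ≈ 0# → ev b y ≈ 0# → ev gcd y ≈ 0#

    Gcd-swap : ∀ {a b} → Gcd a b → Gcd b a
    Gcd-swap (mkGcd g g∥a g∥b van) = mkGcd g g∥b g∥a λ b0 a0 → van a0 b0

    -- Divisibility passes back from `r` and `b` to `a`, while zeros pass forward: y r(y) = c a(y) -
    -- t b(y), and y cancels.
    Gcd-step : ∀ {a b} c t r → c ≢ 0ℤ → c · a ≃ (0ℤ ∷ r) ⊕ t · b → Gcd r b → Gcd a b
    Gcd-step {a} {b} c t r c≢0 ca≃xr+tb (mkGcd g g∥r g∥b van) =
      mkGcd g (∥-combine c t r c≢0 ca≃xr+tb g∥r g∥b) g∥b λ ay≈0 by≈0 →
        van (y-cancel _ (begin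
          y * ev r y                              ≈⟨ ev-shift r y ⟨
          ev (0ℤ ∷ r) y                           ≈⟨ +-identityʳ _ ⟨
          ev (0ℤ ∷ r) y + 0#                      ≈⟨ +-congˡ (trans (*-congˡ by≈0) (zeroʳ _)) ⟨
          ev (0ℤ ∷ r) y + ι t * ev b y            ≈⟨ +-congˡ (ev-· t b y) ⟨
          ev (0ℤ ∷ r) y + ev (t · b) y            ≈⟨ ev-⊕ (0ℤ ∷ r) (t · b) y ⟨
          ev ((0ℤ ∷ r) ⊕ t · b) y                 ≈⟨ ≃⇒ev≈ (c · a) ((0ℤ ∷ r) ⊕ t · b) ca≃xr+tb y ⟨
          ev (c · a) y                            ≈⟨ ev-· c a y ⟩
          ι c * ev a y                            ≈⟨ *-congˡ ay≈0 ⟩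
          ι c * 0#                                ≈⟨ zeroʳ _ ⟩
          0#                                      ∎)) by≈0

    -- The Euclidean algorithm run from the constant term upwards: the lengths play the
    -- role of the degree and a factor x is dropped whenever the constant term vanishes.
    euclid : ∀ s a b → length a ℕ.+ length b ℕ.≤ s → Gcd a b
    euclid s       []      b       _ = mkGcd b (∥-[] b) (∥-refl b) λ _ by≈0 → by≈0
    euclid s       (a ∷ p) []      _ = mkGcd (a ∷ p) (∥-refl _) (∥-[] _) λ ay≈0 _ → ay≈0
    euclid (suc s) (a ∷ p) (b ∷ q) (s≤s p+q<s) with a ℤ.≟ 0ℤ | b ℤ.≟ 0ℤ | ℕ.≤-total (length q) (length p)
    ... | yes ≡.refl | _          | _ = Gcd-step 1ℤ 0ℤ p (λ ()) (0∷-≃ p (b ∷ q)) (euclid s p (b ∷ q) p+q<s)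
    ... | no a≢0     | yes ≡.refl | _ = Gcd-swap (Gcd-step 1ℤ 0ℤ q (λ ()) (0∷-≃ q (a ∷ p))
            (Gcd-swap (euclid s (a ∷ p) q (≡.subst (ℕ._≤ s) (ℕ.+-suc (length p) (length q)) p+q<s))))
    ... | no a≢0 | no b≢0 | inj₁ q≤p = Gcd-step b a (cross a p b q) b≢0 (cross-≃ a p b q)
            (euclid s (cross a p b q) (b ∷ q)
              (ℕ.≤-trans (ℕ.+-monoˡ-≤ (suc (length q)) (length-cross-≤ a p b q q≤p)) p+q<s))
    ... | no a≢0 | no b≢0 | inj₂ p≤q = Gcd-swap (Gcd-step a b (cross b q a p) a≢0 (cross-≃ b q a p)
            (Gcd-swap (euclid s (a ∷ p) (cross b q a p)
              (ℕ.≤-trans (ℕ.+-monoʳ-≤ (suc (length p)) (length-cross-≤ b q a p p≤q))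
                (≡.subst (ℕ._≤ s) (ℕ.+-suc (length p) (length q)) p+q<s)))))

-- The canonical homomorphism from the integers

module CanonicalHom {c ℓ} (R : CommutativeRing c ℓ) where
  open CommutativeRing R hiding (zero)
  open import Algebra.Properties.Ring ring
    using (-0#≈0#; -‿involutive; -‿distribˡ-*; -‿distribʳ-*; -‿+-comm)
  open import Algebra.Properties.Semiring.Mult semiring
    using (×-homo-+; ×1-homo-*) renaming (_×_ to _×ᴿ_)
  open import Relation.Binary.Reasoning.Setoid setoid

  fromℤ : ℤ → Carrier
  fromℤ (+ n)    = n ×ᴿ 1#
  fromℤ -[1+ n ] = - (suc n ×ᴿ 1#)

  fromℤ-⊖ : ∀ m n → fromℤ (m ℤ.⊖ n) ≈ m ×ᴿ 1# - n ×ᴿ 1#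
  fromℤ-⊖ m       zero    = sym (trans (+-congˡ -0#≈0#) (+-identityʳ _))
  fromℤ-⊖ zero    (suc n) = sym (+-identityˡ _)
  fromℤ-⊖ (suc m) (suc n) = begin
    fromℤ (suc m ℤ.⊖ suc n)                        ≡⟨ cong fromℤ (ℤ.[1+m]⊖[1+n]≡m⊖n m n) ⟩
    fromℤ (m ℤ.⊖ n)                                ≈⟨ fromℤ-⊖ m n ⟩
    m ×ᴿ 1# - n ×ᴿ 1#                                ≈⟨ +-congʳ (+-identityʳ _) ⟨
    m ×ᴿ 1# + 0# - n ×ᴿ 1#                           ≈⟨ +-congʳ (+-congˡ (-‿inverseʳ 1#)) ⟨
    m ×ᴿ 1# + (1# - 1#) - n ×ᴿ 1#                    ≈⟨ +-congʳ (+-assoc _ _ _) ⟨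
    m ×ᴿ 1# + 1# - 1# - n ×ᴿ 1#                      ≈⟨ +-congʳ (+-congʳ (+-comm _ _)) ⟩
    1# + m ×ᴿ 1# - 1# - n ×ᴿ 1#                      ≈⟨ +-assoc _ _ _ ⟩
    1# + m ×ᴿ 1# + (- 1# - n ×ᴿ 1#)                  ≈⟨ +-congˡ (-‿+-comm _ _) ⟩
    1# + m ×ᴿ 1# - (1# + n ×ᴿ 1#)                    ∎

  fromℤ-+ : ∀ i j → fromℤ (i ℤ.+ j) ≈ fromℤ i + fromℤ j
  fromℤ-+ (+ m)    (+ n)    = ×-homo-+ 1# m n
  fromℤ-+ (+ m)    -[1+ n ] = fromℤ-⊖ m (suc n)
  fromℤ-+ -[1+ m ] (+ n)    = trans (fromℤ-⊖ n (suc m)) (+-comm _ _)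
  fromℤ-+ -[1+ m ] -[1+ n ] = begin
    - (suc (suc (m ℕ.+ n)) ×ᴿ 1#)       ≡⟨ cong (λ k → - (k ×ᴿ 1#)) (ℕ.+-suc (suc m) n) ⟨
    - ((suc m ℕ.+ suc n) ×ᴿ 1#)         ≈⟨ -‿cong (×-homo-+ 1# (suc m) (suc n)) ⟩
    - (suc m ×ᴿ 1# + suc n ×ᴿ 1#)        ≈⟨ -‿+-comm _ _ ⟨
    - (suc m ×ᴿ 1#) - (suc n ×ᴿ 1#)      ∎

  fromℤ-neg : ∀ i → fromℤ (ℤ.- i) ≈ - fromℤ i
  fromℤ-neg (+ zero)  = sym -0#≈0#
  fromℤ-neg (+ suc n) = refl
  fromℤ-neg -[1+ n ]  = sym (-‿involutive _)

  fromℤ-*⁺ : ∀ m j → fromℤ (+ m ℤ.* j) ≈ m ×ᴿ 1# * fromℤ j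
  fromℤ-*⁺ m (+ n)    = trans (reflexive (cong fromℤ (≡.sym (ℤ.pos-* m n)))) (×1-homo-* m n)
  fromℤ-*⁺ m -[1+ n ] = begin
    fromℤ (+ m ℤ.* -[1+ n ])          ≡⟨ cong fromℤ (ℤ.neg-distribʳ-* (+ m) (+ suc n)) ⟨
    fromℤ (ℤ.- (+ m ℤ.* + suc n))     ≈⟨ fromℤ-neg (+ m ℤ.* + suc n) ⟩
    - fromℤ (+ m ℤ.* + suc n)         ≈⟨ -‿cong (fromℤ-*⁺ m (+ suc n)) ⟩
    - (m ×ᴿ 1# * (suc n ×ᴿ 1#))         ≈⟨ -‿distribʳ-* _ _ ⟩
    m ×ᴿ 1# * - (suc n ×ᴿ 1#)           ∎

  fromℤ-* : ∀ i j → fromℤ (i ℤ.* j) ≈ fromℤ i * fromℤ j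
  fromℤ-* (+ m)    j = fromℤ-*⁺ m j
  fromℤ-* -[1+ m ] j = begin
    fromℤ (-[1+ m ] ℤ.* j)          ≡⟨ cong fromℤ (ℤ.neg-distribˡ-* (+ suc m) j) ⟨
    fromℤ (ℤ.- (+ suc m ℤ.* j))     ≈⟨ fromℤ-neg (+ suc m ℤ.* j) ⟩
    - fromℤ (+ suc m ℤ.* j)         ≈⟨ -‿cong (fromℤ-*⁺ (suc m) j) ⟩
    - (suc m ×ᴿ 1# * fromℤ j)        ≈⟨ -‿distribˡ-* _ _ ⟩
    - (suc m ×ᴿ 1#) * fromℤ j        ∎

  fromℤ-hom : Hom R
  fromℤ-hom = record
    { ⟦_⟧ = fromℤ
    ; +-homo = fromℤ-+
    ; *-homo = fromℤ-*
    ; -‿homo = fromℤ-neg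
    ; 0-homo = refl
    ; 1-homo = +-identityʳ 1#
    }

-- Frobenius congruences modulo a prime

prime∤! : ∀ {l} → Prime l → ∀ {n} → n ℕ.< l → ¬ (l ℕ.∣ n !)
prime∤! {l} l-prime {zero}  n<l l∣1 = ℕ.nonTrivial⇒≢1 {{prime⇒nonTrivial l-prime}} (ℕ.∣1⇒≡1 l∣1)
prime∤! {l} l-prime {suc n} n<l l∣n! = [ ℕ.>⇒∤ n<l , prime∤! l-prime (ℕ.<-trans (ℕ.n<1+n n) n<l) ]′
  (euclidsLemma (suc n) (n !) l-prime l∣n!)

-- The prime divides l! = C(l,k) k! (l - k)! but neither of the two smaller factorials.
prime∣C : ∀ {l} → Prime l → ∀ {k} → 0 ℕ.< k → k ℕ.< l → l ℕ.∣ (l C k)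
prime∣C {l@(suc l′)} l-prime {k@(suc k′)} 0<k k<l = [ (λ l∣C → l∣C) , (λ l∣k!m! → contradiction l∣k!m!
    ([ prime∤! l-prime k<l , prime∤! l-prime (ℕ.s≤s (ℕ.m∸n≤m l′ k′)) ]′ ∘ euclidsLemma (k !)
        ((l ℕ.∸ k) !) l-prime)) ]′
  (euclidsLemma (l C k) (k ! ℕ.* (l ℕ.∸ k) !) l-prime
      (≡.subst (l ℕ.∣_) (≡.sym C*k!m!≡l!) (ℕ.m∣m*n (l′ !))))
  where
  instance _ = k ℕ.!* (l ℕ.∸ k) !≢0
  C*k!m!≡l! : (l C k) ℕ.* (k ! ℕ.* (l ℕ.∸ k) !) ≡ l !
  C*k!m!≡l! = ≡.trans (cong (ℕ._* (k ! ℕ.* (l ℕ.∸ k) !)) (nCk≡n!/k![n-k]! (ℕ.<⇒≤ k<l)))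
    (m/n*n≡m (k![n∸k]!∣n! (ℕ.<⇒≤ k<l)))

module Frobenius {c ℓ} (R : CommutativeRing c ℓ) (hom : Hom R) (x : CommutativeRing.Carrier R)
                 {l : ℕ} (l-prime : Prime l) where
  open CommutativeRing R hiding (zero)
  open Evaluation R hom
  open import Algebra.Properties.Semiring.Exp semiring using (_^_; ^-congˡ)
  open import Algebra.Properties.CommutativeSemiring.Exp commutativeSemiring using (^-distrib-*)
  open import Algebra.Properties.Semiring.Mult semiring
    using (×1-homo-*; ×-assoc-*; ×-congʳ; ×-homo-1) renaming (_×_ to _×ᴿ_)
  open import Algebra.Properties.Semiring.Sum semiring using (sum; sum-init-last)
  open import Algebra.Properties.CommutativeSemiring.Binomial commutativeSemiring
    using (binomialTerm; theorem)
  open import Relation.Binary.Reasoning.Setoid setoid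

  ℤ[x] : Carrier → Set ℓ
  ℤ[x] y = ∃ λ p → y ≈ ev p x

  ℤ[x]-+ : ∀ {y z} → ℤ[x] y → ℤ[x] z → ℤ[x] (y + z)
  ℤ[x]-+ (p , y≈) (q , z≈) = p ⊕ q , trans (+-cong y≈ z≈) (sym (ev-⊕ p q x))

  ℤ[x]-* : ∀ {y z} → ℤ[x] y → ℤ[x] z → ℤ[x] (y * z)
  ℤ[x]-* (p , y≈) (q , z≈) = p ⊗ q , trans (*-cong y≈ z≈) (sym (ev-⊗ p q x))

  ℤ[x]-ι : ∀ a → ℤ[x] (ι a)
  ℤ[x]-ι a = a ∷ [] , sym (trans (+-congˡ (zeroʳ x)) (+-identityʳ _))

  ℤ[x]-0 : ℤ[x] 0#
  ℤ[x]-0 = [] , refl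

  ℤ[x]-1 : ℤ[x] 1#
  ℤ[x]-1 = let p , eq = ℤ[x]-ι 1ℤ in p , trans (sym 1-homo) eq

  ℤ[x]-neg : ∀ {y} → ℤ[x] y → ℤ[x] (- y)
  ℤ[x]-neg {y} (p , y≈) = -1ℤ · p , (begin
    - y             ≈⟨ solve 1 (λ y → :- y := con -1ℤ :* y) refl y ⟩
    ι -1ℤ * y       ≈⟨ *-congˡ y≈ ⟩
    ι -1ℤ * ev p x  ≈⟨ ev-· -1ℤ p x ⟨
    ev (-1ℤ · p) x  ∎)

  ℤ[x]-^ : ∀ {y} n → ℤ[x] y → ℤ[x] (y ^ n)
  ℤ[x]-^ zero    y∈ = ℤ[x]-1
  ℤ[x]-^ (suc n) y∈ = ℤ[x]-* y∈ (ℤ[x]-^ n y∈)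

  ℤ[x]-× : ∀ {y} n → ℤ[x] y → ℤ[x] (n ×ᴿ y)
  ℤ[x]-× zero    y∈ = ℤ[x]-0
  ℤ[x]-× (suc n) y∈ = ℤ[x]-+ y∈ (ℤ[x]-× n y∈)

  ℤ[x]-x : ℤ[x] x
  ℤ[x]-x = X^ 1 , sym (trans (ev-X^ 1 x) (*-identityʳ x))

  infix 4 _≡ˡ_
  -- The quotient `w` must lie in ℤ[x]: l may be a unit of R, and a congruence in R itself would
  -- then say nothing.
  _≡ˡ_ : Carrier → Carrier → Set _
  y ≡ˡ z = ∃ λ w → ℤ[x] w × y ≈ z + ι (+ l) * w

  l∣-sum : ∀ {n} (t : Fin n → Carrier) → (∀ i → t i ≡ˡ 0#) → sum t ≡ˡ 0#
  l∣-sum {zero}  t l∣t = 0# , ℤ[x]-0 , sym (trans (+-identityˡ _) (zeroʳ _))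
  l∣-sum {suc n} t l∣t with l∣t zero | l∣-sum (t ∘ suc) (l∣t ∘ suc)
  ... | v , v∈ , t0≈ | w , w∈ , Σ≈ = v + w , ℤ[x]-+ v∈ w∈ , (begin
    t zero + sum (t ∘ suc)
      ≈⟨ +-cong (trans t0≈ (+-identityˡ _)) (trans Σ≈ (+-identityˡ _)) ⟩
    ι (+ l) * v + ι (+ l) * w                     ≈⟨ distribˡ _ v w ⟨
    ι (+ l) * (v + w)                             ≈⟨ +-identityˡ _ ⟨
    0# + ι (+ l) * (v + w)                        ∎)

  ι≈× : ∀ n → ι (+ n) ≈ n ×ᴿ 1#
  ι≈× zero    = 0-homo
  ι≈× (suc n) = trans (+-homo 1ℤ (+ n)) (+-cong 1-homo (ι≈× n))

  l∣n⇒l∣n× : ∀ {n y} → l ℕ.∣ n → ℤ[x] y → (n ×ᴿ y) ≡ˡ 0#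
  l∣n⇒l∣n× {_} {y} (ℕ.divides q ≡.refl) y∈ = q ×ᴿ y , ℤ[x]-× q y∈ , (begin
    (q ℕ.* l) ×ᴿ y                ≈⟨ ×-congʳ (q ℕ.* l) (*-identityˡ y) ⟨
    (q ℕ.* l) ×ᴿ (1# * y)         ≈⟨ ×-assoc-* (q ℕ.* l) 1# y ⟨
    (q ℕ.* l) ×ᴿ 1# * y           ≈⟨ *-congʳ (×1-homo-* q l) ⟩
    q ×ᴿ 1# * (l ×ᴿ 1#) * y        ≈⟨ *-congʳ (*-congˡ (ι≈× l)) ⟨
    q ×ᴿ 1# * ι (+ l) * y         ≈⟨ *-congʳ (*-comm _ _) ⟩
    ι (+ l) * (q ×ᴿ 1#) * y         ≈⟨ *-assoc _ _ _ ⟩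
    ι (+ l) * (q ×ᴿ 1# * y)        ≈⟨ *-congˡ (×-assoc-* q 1# y) ⟩
    ι (+ l) * (q ×ᴿ (1# * y))       ≈⟨ *-congˡ (×-congʳ q (*-identityˡ y)) ⟩
    ι (+ l) * (q ×ᴿ y)            ≈⟨ +-identityˡ _ ⟨
    0# + ι (+ l) * (q ×ᴿ y)       ∎)

  -- In the binomial theorem all terms but the two outer ones carry a coefficient divisible by l.
  freshman : ∀ {y z} → ℤ[x] y → ℤ[x] z → (y + z) ^ l ≡ˡ y ^ l + z ^ l
  freshman {y} {z} y∈ z∈ = go l l-prime ≡.refl
    where
    -- Both ends can be split off the binomial sum only once l is known to be a successor.
    go : ∀ n → Prime n → n ≡ l → (y + z) ^ l ≡ˡ y ^ l + z ^ l
    go zero    () _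
    go (suc m) _ ≡.refl with l∣-sum (λ i → binomialTerm y z l (suc (inject₁ i))) middle
      where
      middle : ∀ i → binomialTerm y z l (suc (inject₁ i)) ≡ˡ 0#
      middle i = l∣n⇒l∣n× (prime∣C l-prime (s≤s z≤n) (s≤s (≡.subst (ℕ._< m) (≡.sym (Fin.toℕ-inject₁ i)) (Fin.toℕ<n i))))
        (ℤ[x]-* (ℤ[x]-^ (toℕ (suc (inject₁ i))) y∈) (ℤ[x]-^ (l ℕ.∸ toℕ (suc (inject₁ i))) z∈))
    ... | w , w∈ , Σ≈ = w , w∈ , (begin
      (y + z) ^ l
        ≈⟨ theorem l y z ⟩
      t zero + sum (t ∘ suc)
        ≈⟨ +-congˡ (sum-init-last (t ∘ suc)) ⟩
      t zero + (sum (t ∘ suc ∘ inject₁) + t (fromℕ l))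
        ≈⟨ +-cong first (+-cong (trans Σ≈ (+-identityˡ _)) lastTerm) ⟩
      z ^ l + (ι (+ l) * w + y ^ l)
        ≈⟨ solve 3 (λ z w y → z :+ (w :+ y) := y :+ z :+ w) refl (z ^ l) (ι (+ l) * w) (y ^ l) ⟩
      y ^ l + z ^ l + ι (+ l) * w ∎)
      where
      t = binomialTerm y z l
      first : t zero ≈ z ^ l
      first = begin
        (l C 0) ×ᴿ (1# * z ^ l)
          ≡⟨ cong (_×ᴿ (1# * z ^ l)) (≡.trans (nCk≡nC[n∸k] {0} {l} z≤n) (nCn≡1 l)) ⟩
        1 ×ᴿ (1# * z ^ l)       ≈⟨ ×-homo-1 _ ⟩
        1# * z ^ l             ≈⟨ *-identityˡ _ ⟩
        z ^ l                  ∎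
      lastTerm : t (fromℕ l) ≈ y ^ l
      lastTerm = begin
        (l C toℕ (fromℕ l)) ×ᴿ (y ^ toℕ (fromℕ l) * z ^ (l ℕ.∸ toℕ (fromℕ l)))
          ≡⟨ cong (λ k → (l C k) ×ᴿ (y ^ k * z ^ (l ℕ.∸ k))) (Fin.toℕ-fromℕ l) ⟩
        (l C l) ×ᴿ (y ^ l * z ^ (l ℕ.∸ l))
          ≡⟨ cong₂ (λ i j → i ×ᴿ (y ^ l * z ^ j)) (nCn≡1 l) (ℕ.n∸n≡0 l) ⟩
        1 ×ᴿ (y ^ l * 1#) ≈⟨ ×-homo-1 _ ⟩
        y ^ l * 1#       ≈⟨ *-identityʳ _ ⟩
        y ^ l            ∎

  -- The intended pairs are y = p(x) and y′ = p(x^l). Membership in ℤ[x] is included so that the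
  -- relation is closed under sums and products.
  record FrobeniusLift (y y′ : Carrier) : Set (c ⊔ ℓ) where
    constructor lift
    field
      ∈ℤ[x]  : ℤ[x] y
      ∈ℤ[x]′ : ℤ[x] y′
      ≡ˡ     : y ^ l ≡ˡ y′

  lift-+ : ∀ {y y′ z z′} → FrobeniusLift y y′ → FrobeniusLift z z′ → FrobeniusLift (y + z) (y′ + z′)
  lift-+ {y} {y′} {z} {z′} (lift y∈ y′∈ (u , u∈ , yˡ≈)) (lift z∈ z′∈ (v , v∈ , zˡ≈)) with freshman y∈ z∈
  ... | w , w∈ , eq = lift (ℤ[x]-+ y∈ z∈) (ℤ[x]-+ y′∈ z′∈) (u + v + w , ℤ[x]-+ (ℤ[x]-+ u∈ v∈) w∈ , (begin
    (y + z) ^ l                                         ≈⟨ eq ⟩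
    y ^ l + z ^ l + L * w                               ≈⟨ +-congʳ (+-cong yˡ≈ zˡ≈) ⟩
    y′ + L * u + (z′ + L * v) + L * w
      ≈⟨ solve 6 (λ y z u v w l → y :+ l :* u :+ (z :+ l :* v) :+ l :* w := y :+ z :+ l :* (u :+ v :+ w))
           refl y′ z′ u v w L ⟩
    y′ + z′ + L * (u + v + w)                           ∎))
    where L = ι (+ l)

  lift-* : ∀ {y y′ z z′} → FrobeniusLift y y′ → FrobeniusLift z z′ → FrobeniusLift (y * z) (y′ * z′)
  lift-* {y} {y′} {z} {z′} (lift y∈ y′∈ (u , u∈ , yˡ≈)) (lift z∈ z′∈ (v , v∈ , zˡ≈)) =
    lift (ℤ[x]-* y∈ z∈) (ℤ[x]-* y′∈ z′∈)
      (y′ * v + u * z′ + L * (u * v) , ℤ[x]-+ (ℤ[x]-+ (ℤ[x]-* y′∈ v∈) (ℤ[x]-* u∈ z′∈))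
          (ℤ[x]-* (ℤ[x]-ι (+ l)) (ℤ[x]-* u∈ v∈)) , (begin
    (y * z) ^ l                                         ≈⟨ ^-distrib-* y z l ⟩
    y ^ l * z ^ l                                       ≈⟨ *-cong yˡ≈ zˡ≈ ⟩
    (y′ + L * u) * (z′ + L * v)
      ≈⟨ solve 5 (λ y z u v l → (y :+ l :* u) :* (z :+ l :* v) := y :* z :+ l :* (y :* v :+ u :* z :+ l :* (u :* v)))
           refl y′ z′ u v L ⟩
    y′ * z′ + L * (y′ * v + u * z′ + L * (u * v))       ∎))
    where L = ι (+ l)

  0^ : ∀ n → .{{ℕ.NonZero n}} → 0# ^ n ≈ 0#
  0^ (suc n) = zeroˡ _

  private instance _ = prime⇒nonZero l-prime

  ≈⇒≡ˡ : ∀ {y z} → y ≈ z → y ≡ˡ z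
  ≈⇒≡ˡ y≈z = 0# , ℤ[x]-0 , trans y≈z (sym (trans (+-congˡ (zeroʳ _)) (+-identityʳ _)))

  lift-resp : ∀ {y y′ z z′} → y ≈ z → y′ ≈ z′ → FrobeniusLift y y′ → FrobeniusLift z z′
  lift-resp y≈z y′≈z′ (lift (p , y≈) (q , y′≈) (w , w∈ , eq)) =
    lift (p , trans (sym y≈z) y≈) (q , trans (sym y′≈z′) y′≈)
      (w , w∈ , trans (^-congˡ l (sym y≈z)) (trans eq (+-congʳ y′≈z′)))

  lift-0 : FrobeniusLift 0# 0#
  lift-0 = lift ℤ[x]-0 ℤ[x]-0 (≈⇒≡ˡ (0^ l))

  lift-1 : FrobeniusLift 1# 1#
  lift-1 = lift ℤ[x]-1 ℤ[x]-1 (≈⇒≡ˡ (1^ l))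

  lift-x : FrobeniusLift x (x ^ l)
  lift-x = lift ℤ[x]-x (ℤ[x]-^ l ℤ[x]-x) (≈⇒≡ˡ refl)

  -- From 0 = (y - y)^l ≡ y^l + (-y)^l it follows that (-y)^l ≡ -y, with no distinction between l =
  -- 2 and odd l.
  lift-neg : ∀ {y} → FrobeniusLift y y → FrobeniusLift (- y) (- y)
  lift-neg {y} (lift y∈ _ (u , u∈ , yˡ≈)) with freshman y∈ (ℤ[x]-neg y∈)
  ... | w , w∈ , eq = lift (ℤ[x]-neg y∈) (ℤ[x]-neg y∈) (- (u + w) , ℤ[x]-neg (ℤ[x]-+ u∈ w∈) , (begin
    (- y) ^ l
      ≈⟨ solve 4 (λ n y u w → n := :- y :+ :- (u :+ w) :+ (y :+ u :+ n :+ w)) refl ((- y) ^ l) y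
          (L * u) (L * w) ⟩
    - y - (L * u + L * w) + (y + L * u + (- y) ^ l + L * w)
      ≈⟨ +-congˡ (+-congʳ (+-congʳ yˡ≈)) ⟨
    - y - (L * u + L * w) + (y ^ l + (- y) ^ l + L * w)
      ≈⟨ +-congˡ eq ⟨
    - y - (L * u + L * w) + (y - y) ^ l
      ≈⟨ +-congˡ (trans (^-congˡ l (-‿inverseʳ y)) (0^ l)) ⟩
    - y - (L * u + L * w) + 0#
      ≈⟨ +-identityʳ _ ⟩
    - y - (L * u + L * w)
      ≈⟨ solve 4 (λ y u w l → :- y :+ :- (l :* u :+ l :* w) := :- y :+ l :* (:- (u :+ w))) refl y u w L ⟩
    - y + L * (- (u + w)) ∎))
    where L = ι (+ l)

  -- Fermat's little theorem, by induction on n through (1 + n)^l ≡ 1 + n^l.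
  lift-ℕ : ∀ n → FrobeniusLift (ι (+ n)) (ι (+ n))
  lift-ℕ zero    = lift-resp (sym 0-homo) (sym 0-homo) lift-0
  lift-ℕ (suc n) = lift-resp eq eq (lift-+ lift-1 (lift-ℕ n))
    where eq = sym (trans (+-homo 1ℤ (+ n)) (+-congʳ 1-homo))

  lift-ι : ∀ a → FrobeniusLift (ι a) (ι a)
  lift-ι (+ n)    = lift-ℕ n
  lift-ι -[1+ n ] = lift-resp eq eq (lift-neg (lift-ℕ (suc n)))
    where eq = sym (-‿homo (+ suc n))

  -- In Horner form the coefficients are fixed by Fermat and x goes to x^l.
  frobenius : ∀ p → FrobeniusLift (ev p x) (ev p (x ^ l))
  frobenius []      = lift-0
  frobenius (a ∷ p) = lift-+ (lift-ι a) (lift-* lift-x (frobenius p))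

-- Removing a prime from the scale of a divisibility

module _ {l : ℕ} (l-prime : Prime l) where

  prime∤* : ∀ i j → ¬ (+ l ℤ.∣ i) → ¬ (+ l ℤ.∣ j) → ¬ (+ l ℤ.∣ i ℤ.* j)
  prime∤* i j l∤i l∤j (ℤ.divides k eq) = [ l∤i , l∤j ]′
      (prime∣*⇒ l-prime i j k (≡.trans eq (ℤ.*-comm k (+ l))))

  prime∤1 : ¬ (+ l ℤ.∣ 1ℤ)
  prime∤1 l∣1 = ℕ.nonTrivial⇒≢1 {{prime⇒nonTrivial l-prime}} (ℕ.∣1⇒≡1 (ℤ.∣⇒∣ᵤ l∣1))

  prime∤^ : ∀ i n → ¬ (+ l ℤ.∣ i) → ¬ (+ l ℤ.∣ i ^ᶻ n)
  prime∤^ i zero    l∤i = prime∤1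
  prime∤^ i (suc n) l∤i = prime∤* i (i ^ᶻ n) l∤i (prime∤^ i n l∤i)

  ∤⇒≢0 : ∀ {i} → ¬ (+ l ℤ.∣ i) → i ≢ 0ℤ
  ∤⇒≢0 l∤i ≡.refl = l∤i (ℤ.divides 0ℤ ≡.refl)

  -- For f = x^k - 1 the scale enters an argument modulo l; for `c` it is only cancelled in R, so
  -- being nonzero suffices. `content` carries zeros of `g₀` over to `g`.
  record Reduced (g₀ f c : Poly) : Set where
    field
      g       : Poly
      g∥f     : g ∥ f
      g∥c     : g ∥ c
      l∤scale : ¬ (+ l ℤ.∣ _∥_.scale g∥f)
      content : ℤ
      content≢0 : content ≢ 0ℤ
      g₀≃     : g₀ ≃ content · g

  module _ where
    open ℤ-Eval using (solve; _:=_; _:+_; _:*_; :-_; con; ev-·; ev-⊗; ev-X^)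
    open ≡.≡-Reasoning
    private
      instance _ = prime⇒nonZero l-prime
      +l≢0 : + l ≢ 0ℤ
      +l≢0 eq = ℕ.≢-nonZero⁻¹ l (ℤ.+-injective eq)

    cancel-prime : ∀ i j → + l ℤ.* i ≡ + l ℤ.* j → i ≡ j
    cancel-prime i j = ℤ.*-cancelˡ-≡ (+ l) i j

    -- Gauss' lemma removes the common factors l of the scale and of g or its cofactor.
    reduce : ∀ s {g f c} (g∥f : g ∥ f) → g ∥ c → abs (_∥_.scale g∥f) ℕ.≤ s → Reduced g f c
    reduce zero (divides N N≢0 e h eq) g∥c N≤0 =
      contradiction (ℤ.∣i∣≡0⇒i≡0 (ℕ.n≤0⇒n≡0 N≤0)) N≢0
    reduce (suc s) {g} {f} {c} g∥f@(divides N N≢0 e h eq) g∥c@(divides M M≢0 e′ q eq′) N≤s with + l ℤ.∣? N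
    ... | no l∤N = record
      { g = g ; g∥f = g∥f ; g∥c = g∥c ; l∤scale = l∤N ; content = 1ℤ ; content≢0 = λ ()
      ; g₀≃ = λ n → ≡.sym (≡.trans (ev-· 1ℤ g (+ suc n)) (ℤ.*-identityˡ _)) }
    ... | yes (ℤ.divides N′ N≡) = [ reduce-g , reduce-h ]′ (gauss l-prime g h (N′ · (X^ e ⊗ f)) λ n → begin
        at g n ℤ.* at h n                                 ≡⟨ eq n ⟨
        N ℤ.* (+ suc n) ^ᶻ e ℤ.* at f n                   ≡⟨ lN′≡ n ⟩
        + l ℤ.* (N′ ℤ.* (+ suc n) ^ᶻ e ℤ.* at f n)
          ≡⟨ cong (+ l ℤ.*_) (≡.trans (ev-· N′ (X^ e ⊗ f) (+ suc n)) (≡.trans (cong (N′ ℤ.*_)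
               (≡.trans (ev-⊗ (X^ e) f (+ suc n)) (cong (ℤ._* at f n) (ev-X^ e (+ suc n)))))
                   (≡.sym (ℤ.*-assoc N′ _ _)))) ⟨
        + l ℤ.* at (N′ · (X^ e ⊗ f)) n                    ∎)
      where
      lN′≡ : ∀ n → N ℤ.* (+ suc n) ^ᶻ e ℤ.* at f n ≡ + l ℤ.* (N′ ℤ.* (+ suc n) ^ᶻ e ℤ.* at f n)
      lN′≡ n = ≡.trans (cong (λ z → z ℤ.* (+ suc n) ^ᶻ e ℤ.* at f n) N≡)
        (solve 4 (λ N l x f → N :* l :* x :* f := l :* (N :* x :* f)) ≡.refl N′ (+ l)
            ((+ suc n) ^ᶻ e) (at f n))

      N′≢0 : N′ ≢ 0ℤ
      N′≢0 ≡.refl = N≢0 N≡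

      N′≤s : abs N′ ℕ.≤ s
      N′≤s = ℕ.≤-pred (ℕ.≤-trans (≡.subst (abs N′ ℕ.<_) (≡.sym (≡.trans (cong abs N≡) (ℤ.abs-* N′ (+ l))))
        (ℕ.m<m*n (abs N′) l {{ℕ.≢-nonZero (λ z → N′≢0 (ℤ.∣i∣≡0⇒i≡0 z))}}
            (ℕ.nonTrivial⇒n>1 l {{prime⇒nonTrivial l-prime}}))) N≤s)

      reduce-g : Factor l-prime g → Reduced g f c
      reduce-g (g′ , g≡) = record
        { Reduced r hiding (content; content≢0; g₀≃)
        ; content = + l ℤ.* Reduced.content r
        ; content≢0 = *-≢0 +l≢0 (Reduced.content≢0 r)
        ; g₀≃ = λ n → begin
            at g n                                        ≡⟨ g≡ n ⟩
            + l ℤ.* at g′ n                               ≡⟨ cong (+ l ℤ.*_) (Reduced.g₀≃ r n) ⟩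
            + l ℤ.* at (K · G) n                          ≡⟨ cong (+ l ℤ.*_) (ev-· K G (+ suc n)) ⟩
            + l ℤ.* (K ℤ.* at G n)                        ≡⟨ ℤ.*-assoc (+ l) K _ ⟨
            + l ℤ.* K ℤ.* at G n                          ≡⟨ ev-· (+ l ℤ.* K) G (+ suc n) ⟨
            at ((+ l ℤ.* K) · G) n                        ∎
        }
        where
        g′∥f : g′ ∥ f
        g′∥f = divides N′ N′≢0 e h λ n → cancel-prime _ _ (begin
          + l ℤ.* (N′ ℤ.* (+ suc n) ^ᶻ e ℤ.* at f n)      ≡⟨ lN′≡ n ⟨
          N ℤ.* (+ suc n) ^ᶻ e ℤ.* at f n                 ≡⟨ eq n ⟩
          at g n ℤ.* at h n                               ≡⟨ cong (ℤ._* at h n) (g≡ n) ⟩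
          + l ℤ.* at g′ n ℤ.* at h n                      ≡⟨ ℤ.*-assoc (+ l) (at g′ n) (at h n) ⟩
          + l ℤ.* (at g′ n ℤ.* at h n)                    ∎)
        g′∥c : g′ ∥ c
        -- The scale for `c` is kept, so the factor l taken from `g` moves to the cofactor.
        g′∥c = divides M M≢0 e′ ((+ l) · q) λ n → begin
          M ℤ.* (+ suc n) ^ᶻ e′ ℤ.* at c n                ≡⟨ eq′ n ⟩
          at g n ℤ.* at q n                               ≡⟨ cong (ℤ._* at q n) (g≡ n) ⟩
          + l ℤ.* at g′ n ℤ.* at q n
            ≡⟨ solve 3 (λ l g q → l :* g :* q := g :* (l :* q)) ≡.refl (+ l) (at g′ n) (at q n) ⟩
          at g′ n ℤ.* (+ l ℤ.* at q n)
            ≡⟨ cong (at g′ n ℤ.*_) (ev-· (+ l) q (+ suc n)) ⟨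
          at g′ n ℤ.* at ((+ l) · q) n                      ∎
        r = reduce s g′∥f g′∥c N′≤s
        K = Reduced.content r
        G = Reduced.g r

      reduce-h : Factor l-prime h → Reduced g f c
      reduce-h (h′ , h≡) = reduce s (divides N′ N′≢0 e h′ λ n → cancel-prime _ _ (begin
          + l ℤ.* (N′ ℤ.* (+ suc n) ^ᶻ e ℤ.* at f n)      ≡⟨ lN′≡ n ⟨
          N ℤ.* (+ suc n) ^ᶻ e ℤ.* at f n                 ≡⟨ eq n ⟩
          at g n ℤ.* at h n                               ≡⟨ cong (at g n ℤ.*_) (h≡ n) ⟩
          at g n ℤ.* (+ l ℤ.* at h′ n)
            ≡⟨ solve 3 (λ l g h → g :* (l :* h) := l :* (g :* h)) ≡.refl (+ l) (at g n) (at h′ n) ⟩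
          + l ℤ.* (at g n ℤ.* at h′ n)                    ∎)) g∥c N′≤s

-- Integral linear systems and divisibility by a prime in ℤ[ζ]

module Domain {c ℓ} (R : CommutativeRing c ℓ) (domain : IsIntegralDomain R) (char0 : CharZero R) where
  open CommutativeRing R hiding (zero)
  open CanonicalHom R
  open Evaluation R fromℤ-hom
  open Transfer R fromℤ-hom
  open import Algebra.Properties.Ring ring using (-‿involutive; -0#≈0#)
  open import Algebra.Properties.Semiring.Exp semiring using (_^_; ^-homo-*)
  open import Algebra.Properties.Semiring.Mult semiring using () renaming (_×_ to _×ᴿ_)
  open import Algebra.Properties.Semiring.Sum semiring using (sum)
  open import Relation.Binary.Reasoning.Setoid setoid

  natR≡× : ∀ n → natR R n ≡ n ×ᴿ 1#
  natR≡× zero    = ≡.refl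
  natR≡× (suc n) = cong (λ z → 1# + z) (natR≡× n)

  1≉0 : ¬ (1# ≈ 0#)
  1≉0 1≈0 = char0 0 (trans (+-identityʳ 1#) 1≈0)

  ι≈0⇒≡0 : ∀ i → ι i ≈ 0# → i ≡ 0ℤ
  ι≈0⇒≡0 (+ zero)  _   = ≡.refl
  ι≈0⇒≡0 (+ suc n) ι≈0 = contradiction (trans (reflexive (natR≡× (suc n))) ι≈0) (char0 n)
  ι≈0⇒≡0 -[1+ n ]  ι≈0 = contradiction (begin
    natR R (suc n)          ≡⟨ natR≡× (suc n) ⟩
    suc n ×ᴿ 1#             ≈⟨ -‿involutive _ ⟨
    - - (suc n ×ᴿ 1#)       ≈⟨ -‿cong ι≈0 ⟩
    - 0#                    ≈⟨ -0#≈0# ⟩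
    0#                      ∎) (char0 n)

  ι-cancel : ∀ {i z} → i ≢ 0ℤ → ι i * z ≈ 0# → z ≈ 0#
  ι-cancel {i} {z} i≢0 eq = [ (λ ι≈0 → contradiction (ι≈0⇒≡0 i ι≈0) i≢0) , (λ z≈0 → z≈0) ]′
      (domain (ι i) z eq)

  ι-^ : ∀ i n → ι (i ^ᶻ n) ≈ ι i ^ n
  ι-^ i zero    = 1-homo
  ι-^ i (suc n) = trans (*-homo i (i ^ᶻ n)) (*-congˡ (ι-^ i n))

  comb : ∀ {n} → (Fin n → ℤ) → (Fin n → Carrier) → Carrier
  comb V v = sum λ j → ι (V j) * v j

  comb-linear : ∀ {n} a b (V W : Fin n → ℤ) v →
                comb (λ j → a ℤ.* V j ℤ.+ b ℤ.* W j) v ≈ ι a * comb V v + ι b * comb W v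
  comb-linear {zero}  a b V W v = sym (trans (+-cong (zeroʳ _) (zeroʳ _)) (+-identityˡ _))
  comb-linear {suc n} a b V W v = begin
    ι (a ℤ.* V zero ℤ.+ b ℤ.* W zero) * v zero
      + comb (λ j → a ℤ.* V (suc j) ℤ.+ b ℤ.* W (suc j)) (v ∘ suc)
      ≈⟨ +-cong (*-congʳ (trans (+-homo (a ℤ.* V zero) (b ℤ.* W zero)) (+-cong (*-homo a (V zero)) (*-homo b (W zero))))) (comb-linear a b (V ∘ suc) (W ∘ suc) (v ∘ suc)) ⟩
    (ι a * ι (V zero) + ι b * ι (W zero)) * v zero
      + (ι a * comb (V ∘ suc) (v ∘ suc) + ι b * comb (W ∘ suc) (v ∘ suc))
      ≈⟨ solve 7 (λ a b V W v S T → (a :* V :+ b :* W) :* v :+ (a :* S :+ b :* T) := a :* (V :* v :+ S) :+ b :* (W :* v :+ T))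
           refl (ι a) (ι b) (ι (V zero)) (ι (W zero)) (v zero) (comb (V ∘ suc) (v ∘ suc))
               (comb (W ∘ suc) (v ∘ suc)) ⟩
    ι a * comb V v + ι b * comb W v ∎

  comb-zero : ∀ {n} (V : Fin n → ℤ) v → (∀ j → v j ≈ 0#) → comb V v ≈ 0#
  comb-zero {zero}  V v v≈0 = refl
  comb-zero {suc n} V v v≈0 = trans
      (+-cong (trans (*-congˡ (v≈0 zero)) (zeroʳ _)) (comb-zero (V ∘ suc) (v ∘ suc) (v≈0 ∘ suc)))
          (+-identityˡ _)

  comb-zeroˡ : ∀ {n} (v : Fin n → Carrier) → comb (λ _ → 0ℤ) v ≈ 0#
  comb-zeroˡ {zero}  v = refl
  comb-zeroˡ {suc n} v = trans (+-cong (trans (*-congʳ 0-homo) (zeroˡ _)) (comb-zeroˡ (v ∘ suc)))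
      (+-identityˡ _)

  δ : ∀ {n} → Fin n → Fin n → ℤ
  δ zero    zero    = 1ℤ
  δ zero    (suc j) = 0ℤ
  δ (suc i) zero    = 0ℤ
  δ (suc i) (suc j) = δ i j

  comb-δ : ∀ {n} i (v : Fin n → Carrier) → comb (δ i) v ≈ v i
  comb-δ zero    v = trans (+-cong (trans (*-congʳ 1-homo) (*-identityˡ _)) (comb-zeroˡ (v ∘ suc)))
      (+-identityʳ _)
  comb-δ (suc i) v = trans (+-cong (trans (*-congʳ 0-homo) (zeroˡ _)) (comb-δ i (v ∘ suc)))
      (+-identityˡ _)

  module _ {l : ℕ} (l-prime : Prime l) where

    -- The system is diagonal and invertible modulo l; Gaussian elimination preserves this.
    elimination : ∀ {n} (v : Fin n → Carrier) (N : Fin n → ℤ) (V : Fin n → Fin n → ℤ) →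
                  (∀ i → ¬ (+ l ℤ.∣ N i)) →
                  (∀ i → ι (N i) * v i ≈ ι (+ l) * comb (V i) v) →
                  ∀ i → v i ≈ 0#
    elimination {suc n} v N V l∤N eq = λ { zero → v₀≈0 ; (suc i) → v₊≈0 i }
      where
      L   = + l
      -- The diagonal term of row 0 is moved to the left; modulo l nothing changes.
      N₀  = N zero ℤ.+ ℤ.- (L ℤ.* V zero zero)
      v₀  = v zero
      v₊  = v ∘ suc
      S : Fin (suc n) → Carrier
      S i = comb (V i ∘ suc) v₊

      l∤N₀ : ¬ (L ℤ.∣ N₀)
      l∤N₀ l∣N₀ = l∤N zero (ℤ.∣m+n∣n⇒∣m l∣N₀ (ℤ.∣m⇒∣-m (ℤ.divides (V zero zero) (ℤ.*-comm L _))))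

      ιN₀ : ι N₀ ≈ ι (N zero) - ι L * ι (V zero zero)
      ιN₀ = trans (+-homo (N zero) (ℤ.- (L ℤ.* V zero zero)))
        (+-congˡ (trans (-‿homo (L ℤ.* V zero zero)) (-‿cong (*-homo L (V zero zero)))))

      N₀v₀≈ : ι N₀ * v₀ ≈ ι L * S zero
      N₀v₀≈ = begin
        ι N₀ * v₀
          ≈⟨ *-congʳ ιN₀ ⟩
        (ι (N zero) - ι L * ι (V zero zero)) * v₀
          ≈⟨ solve 4 (λ N L V v → (N :- L :* V) :* v := N :* v :- L :* (V :* v)) refl (ι (N zero))
              (ι L) (ι (V zero zero)) v₀ ⟩
        ι (N zero) * v₀ - ι L * (ι (V zero zero) * v₀)
          ≈⟨ +-congʳ (eq zero) ⟩
        ι L * (ι (V zero zero) * v₀ + S zero) - ι L * (ι (V zero zero) * v₀)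
          ≈⟨ solve 3 (λ L V S → L :* (V :+ S) :- L :* V := L :* S) refl (ι L) (ι (V zero zero) * v₀)
              (S zero) ⟩
        ι L * S zero ∎

      v₊≈0 : ∀ i → v₊ i ≈ 0#
      -- Each remaining row is multiplied by N₀, so that N₀ v₀ can be replaced by row 0 without a
      -- division; its new diagonal entry is still prime to l.
      v₊≈0 = elimination v₊ (λ i → N₀ ℤ.* N (suc i))
        (λ i j → L ℤ.* V (suc i) zero ℤ.* V zero (suc j) ℤ.+ N₀ ℤ.* V (suc i) (suc j))
        (λ i → prime∤* l-prime N₀ (N (suc i)) l∤N₀ (l∤N (suc i)))
        λ i → begin
          ι (N₀ ℤ.* N (suc i)) * v₊ i
            ≈⟨ *-congʳ (*-homo N₀ _) ⟩
          ι N₀ * ι (N (suc i)) * v₊ i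
            ≈⟨ *-assoc _ _ _ ⟩
          ι N₀ * (ι (N (suc i)) * v₊ i)
            ≈⟨ *-congˡ (eq (suc i)) ⟩
          ι N₀ * (ι L * (ι (V (suc i) zero) * v₀ + S (suc i)))
            ≈⟨ solve 5 (λ N L V v S → N :* (L :* (V :* v :+ S)) := L :* (V :* (N :* v) :+ N :* S))
                 refl (ι N₀) (ι L) (ι (V (suc i) zero)) v₀ (S (suc i)) ⟩
          ι L * (ι (V (suc i) zero) * (ι N₀ * v₀) + ι N₀ * S (suc i))
            ≈⟨ *-congˡ (+-congʳ (*-congˡ N₀v₀≈)) ⟩
          ι L * (ι (V (suc i) zero) * (ι L * S zero) + ι N₀ * S (suc i))
            ≈⟨ *-congˡ (+-congʳ (trans (sym (*-assoc _ _ _)) (*-congʳ (trans (*-comm _ _) (sym (*-homo L (V (suc i) zero))))))) ⟩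
          ι L * (ι (L ℤ.* V (suc i) zero) * S zero + ι N₀ * S (suc i))
            ≈⟨ *-congˡ (comb-linear (L ℤ.* V (suc i) zero) N₀ (V zero ∘ suc) (V (suc i) ∘ suc) v₊) ⟨
          ι L * comb (λ j → L ℤ.* V (suc i) zero ℤ.* V zero (suc j) ℤ.+ N₀ ℤ.* V (suc i) (suc j)) v₊ ∎

      v₀≈0 : v₀ ≈ 0#
      v₀≈0 = ι-cancel (∤⇒≢0 l-prime l∤N₀)
          (trans N₀v₀≈ (trans (*-congˡ (comb-zero (V zero ∘ suc) v₊ v₊≈0)) (zeroʳ _)))

  ^-*-1 : ∀ {y} k → y ^ k ≈ 1# → ∀ n → y ^ (n ℕ.* k) ≈ 1#
  ^-*-1 k yᵏ≈1 zero    = refl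
  ^-*-1 {y} k yᵏ≈1 (suc n) = trans (^-homo-* y k (n ℕ.* k))
      (trans (*-cong yᵏ≈1 (^-*-1 k yᵏ≈1 n)) (*-identityˡ _))

  module _ (k : ℕ) .{{_ : ℕ.NonZero k}} where

    ^-% : ∀ {y} → y ^ k ≈ 1# → ∀ n → y ^ n ≈ y ^ (n ℕ.% k)
    ^-% {y} yᵏ≈1 n = begin
      y ^ n                                    ≡⟨ cong (y ^_) (m≡m%n+[m/n]*n n k) ⟩
      y ^ (n ℕ.% k ℕ.+ (n ℕ./ k) ℕ.* k)        ≈⟨ ^-homo-* y (n ℕ.% k) _ ⟩
      y ^ (n ℕ.% k) * y ^ ((n ℕ./ k) ℕ.* k)    ≈⟨ *-congˡ (^-*-1 k yᵏ≈1 (n ℕ./ k)) ⟩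
      y ^ (n ℕ.% k) * 1#                       ≈⟨ *-identityʳ _ ⟩
      y ^ (n ℕ.% k)                            ∎

    module _ (ζ : Carrier) (ζᵏ≈1 : ζ ^ k ≈ 1#) where

      powers : Fin k → Carrier
      powers j = ζ ^ toℕ j

      power-comb : ∀ n → ∃ λ V → ζ ^ n ≈ comb V powers
      power-comb n = δ i , (begin
        ζ ^ n             ≈⟨ ^-% ζᵏ≈1 n ⟩
        ζ ^ (n ℕ.% k)     ≡⟨ cong (ζ ^_) (Fin.toℕ-fromℕ< (m%n<n n k)) ⟨
        ζ ^ toℕ i         ≈⟨ comb-δ i powers ⟨
        comb (δ i) powers ∎)
        where i = Fin.fromℕ< (m%n<n n k)

      -- The factor ζ^n makes the induction close: (a + ζ p(ζ)) ζ^n = a ζ^n + p(ζ) ζ^(n+1).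
      ev-comb : ∀ p n → ∃ λ V → ev p ζ * ζ ^ n ≈ comb V powers
      ev-comb []      n = (λ _ → 0ℤ) , trans (zeroˡ _) (sym (comb-zeroˡ powers))
      ev-comb (a ∷ p) n with power-comb n | ev-comb p (suc n)
      ... | V , ζⁿ≈ | W , pζ≈ = (λ j → a ℤ.* V j ℤ.+ 1ℤ ℤ.* W j) , (begin
        (ι a + ζ * ev p ζ) * ζ ^ n
          ≈⟨ solve 4 (λ a z p y → (a :+ z :* p) :* y := a :* y :+ con 1ℤ :* (p :* (z :* y))) refl
              (ι a) ζ (ev p ζ) (ζ ^ n) ⟩
        ι a * ζ ^ n + ι 1ℤ * (ev p ζ * ζ ^ suc n)
          ≈⟨ +-cong (*-congˡ ζⁿ≈) (*-congˡ pζ≈) ⟩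
        ι a * comb V powers + ι 1ℤ * comb W powers
          ≈⟨ comb-linear a 1ℤ V W powers ⟨
        comb (λ j → a ℤ.* V j ℤ.+ 1ℤ ℤ.* W j) powers ∎)

      -- The determinant trick: multiplying B = l p(ζ) by each ζ^i gives a homogeneous system in the
      -- powers of ζ, which may be linearly dependent. Elimination makes all of them 0, among them
      -- ζ^0 = 1.
      prime∤⇒∉lℤ[ζ] : ∀ {l} → Prime l → ∀ B p → ¬ (+ l ℤ.∣ B) → ¬ (ι B ≈ ι (+ l) * ev p ζ)
      prime∤⇒∉lℤ[ζ] {l} l-prime B p l∤B eq = 1≉0
          (trans (reflexive (cong (ζ ^_) (≡.sym (Fin.toℕ-fromℕ< 0<k))))
        (elimination l-prime powers (λ _ → B) (λ i → proj₁ (ev-comb p (toℕ i))) (λ _ → l∤B)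
          (λ i → begin
            ι B * powers i                   ≈⟨ *-congʳ eq ⟩
            ι (+ l) * ev p ζ * powers i      ≈⟨ *-assoc _ _ _ ⟩
            ι (+ l) * (ev p ζ * powers i)    ≈⟨ *-congˡ (proj₂ (ev-comb p (toℕ i))) ⟩
            ι (+ l) * comb (proj₁ (ev-comb p (toℕ i))) powers ∎)
          (Fin.fromℕ< 0<k)))
        where 0<k = ℕ.>-nonZero⁻¹ k

-- Integer polynomials vanishing at roots of unity

module _ where
  open ℤ-Eval using (ev-·; ev-⊗; ev-X^)

  -- As an equality of two polynomials, divisibility can be transferred to R for derivatives as well
  -- as for values.
  ∥⇒≃ : ∀ {g a} (g∥a : g ∥ a) → let open _∥_ g∥a in scale · (X^ shift ⊗ a) ≃ g ⊗ cofactor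
  ∥⇒≃ {g} {a} (divides N _ e q eq) n =
    ≡.trans (ev-· N (X^ e ⊗ a) x)
      (≡.trans (cong (N ℤ.*_) (≡.trans (ev-⊗ (X^ e) a x) (cong (ℤ._* at a n) (ev-X^ e x))))
        (≡.trans (≡.sym (ℤ.*-assoc N (x ^ᶻ e) (at a n)))
          (≡.trans (eq n) (≡.sym (ev-⊗ g q x)))))
    where
    x = + suc n

module RootsOfUnity {c ℓ} (R : CommutativeRing c ℓ) (domain : IsIntegralDomain R)
    (char0 : CharZero R) where
  open CommutativeRing R hiding (zero)
  open CanonicalHom R
  open Evaluation R fromℤ-hom
  open Transfer R fromℤ-hom
  open Domain R domain char0
  open import Algebra.Properties.Semiring.Exp semiring using (_^_; ^-congˡ; ^-assocʳ)
  open import Algebra.Properties.CommutativeSemiring.Exp commutativeSemiring using (^-distrib-*)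
  open import Relation.Binary.Reasoning.Setoid setoid

  module _ (k : ℕ) .{{_ : ℕ.NonZero k}} where

    root-cancel : ∀ {y} → y ^ k ≈ 1# → ∀ z → y * z ≈ 0# → z ≈ 0#
    root-cancel {y} yᵏ≈1 z yz≈0 = begin
      z                       ≈⟨ *-identityˡ z ⟨
      1# * z                  ≈⟨ *-congʳ yᵏ≈1 ⟨
      y ^ k * z               ≡⟨ cong (λ k → y ^ k * z) (ℕ.suc-pred k) ⟨
      y * y ^ ℕ.pred k * z    ≈⟨ *-congʳ (*-comm _ _) ⟩
      y ^ ℕ.pred k * y * z    ≈⟨ *-assoc _ _ _ ⟩
      y ^ ℕ.pred k * (y * z)  ≈⟨ *-congˡ yz≈0 ⟩
      y ^ ℕ.pred k * 0#       ≈⟨ zeroʳ _ ⟩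
      0#                      ∎

    root-^-cancel : ∀ {y} → y ^ k ≈ 1# → ∀ e z → y ^ e * z ≈ 0# → z ≈ 0#
    root-^-cancel yᵏ≈1 zero    z eq = trans (sym (*-identityˡ z)) eq
    root-^-cancel yᵏ≈1 (suc e) z eq =
      root-^-cancel yᵏ≈1 e z (root-cancel yᵏ≈1 _ (trans (sym (*-assoc _ _ _)) eq))

    root-^ : ∀ {y} → y ^ k ≈ 1# → ∀ n → (y ^ n) ^ k ≈ 1#
    root-^ {y} yᵏ≈1 n = trans (^-assocʳ y n k) (^-*-1 k yᵏ≈1 n)

    Xᵏ-1 : Poly
    Xᵏ-1 = X^ k ⊕ (-1ℤ ∷ [])

    ev-Xᵏ-1 : ∀ {y} → y ^ k ≈ 1# → ev Xᵏ-1 y ≈ 0#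
    ev-Xᵏ-1 {y} yᵏ≈1 = begin
      ev Xᵏ-1 y                   ≈⟨ ev-⊕ (X^ k) _ y ⟩
      ev (X^ k) y + (ι -1ℤ + y * 0#)
        ≈⟨ +-cong (trans (ev-X^ k y) yᵏ≈1) (trans (+-congˡ (zeroʳ y)) (+-identityʳ _)) ⟩
      1# + ι -1ℤ                  ≈⟨ +-congʳ 1-homo ⟨
      ι 1ℤ + ι -1ℤ                ≈⟨ +-homo 1ℤ -1ℤ ⟨
      ι 0ℤ                        ≈⟨ 0-homo ⟩
      0#                          ∎

    d-Xᵏ-1 : ∀ {y} → y ^ k ≈ 1# → y * d Xᵏ-1 y ≈ ι (+ k)
    d-Xᵏ-1 {y} yᵏ≈1 = begin
      y * d Xᵏ-1 y                        ≈⟨ *-congˡ (d-⊕ (X^ k) _ y) ⟩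
      y * (d (X^ k) y + (0# + y * 0#))     ≈⟨ *-congˡ (+-congˡ (trans (+-identityˡ _) (zeroʳ y))) ⟩
      y * (d (X^ k) y + 0#)                ≈⟨ *-congˡ (+-identityʳ _) ⟩
      y * d (X^ k) y                       ≈⟨ d-X^ k y ⟩
      ι (+ k) * y ^ k                      ≈⟨ *-congˡ yᵏ≈1 ⟩
      ι (+ k) * 1#                         ≈⟨ *-identityʳ _ ⟩
      ι (+ k)                              ∎

    ∥-ev : ∀ {g a} (g∥a : g ∥ a) → let open _∥_ g∥a in
           ∀ y → ι scale * (y ^ shift * ev a y) ≈ ev g y * ev cofactor y
    ∥-ev {g} {a} g∥a@(divides N _ e q eq) y = begin
      ι N * (y ^ e * ev a y)       ≈⟨ *-congˡ (*-congʳ (ev-X^ e y)) ⟨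
      ι N * (ev (X^ e) y * ev a y) ≈⟨ *-congˡ (ev-⊗ (X^ e) a y) ⟨
      ι N * ev (X^ e ⊗ a) y        ≈⟨ ev-· N (X^ e ⊗ a) y ⟨
      ev (N · (X^ e ⊗ a)) y        ≈⟨ ≃⇒ev≈ (N · (X^ e ⊗ a)) (g ⊗ q) (∥⇒≃ g∥a) y ⟩
      ev (g ⊗ q) y                 ≈⟨ ev-⊗ g q y ⟩
      ev g y * ev q y              ∎

    module _ {l : ℕ} (l-prime : Prime l) (l∤k : ¬ (l ℕ.∣ k)) (ζ : Carrier) (ζᵏ≈1 : ζ ^ k ≈ 1#) where
      open Frobenius R fromℤ-hom ζ l-prime

      d∈ℤ[ζ] : ∀ p → ℤ[x] (d p ζ)
      d∈ℤ[ζ] []      = ℤ[x]-0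
      d∈ℤ[ζ] (a ∷ p) = ℤ[x]-+ (p , refl) (ℤ[x]-* ℤ[x]-x (d∈ℤ[ζ] p))

      -- If both vanished, differentiating g h = N x^e (x^k - 1) at ζ and raising to the
      -- l-th power would make (N k)^l divisible by l in ℤ[ζ], since h(ζ)^l ≡ h(ζ^l) mod l.
      separable : ∀ {g} (g∥f : g ∥ Xᵏ-1) → ¬ (+ l ℤ.∣ _∥_.scale g∥f) → ev g ζ ≈ 0# →
                  ¬ (ev (_∥_.cofactor g∥f) (ζ ^ l) ≈ 0#)
      separable {g} g∥f@(divides N _ e h _) l∤N gζ≈0 hζˡ≈0
        with w , (p , w≈) , hˡ≈ ← FrobeniusLift.≡ˡ (frobenius h) =
        prime∤⇒∉lℤ[ζ] k ζ ζᵏ≈1 l-prime B (proj₁ inℤ[ζ]) l∤B (begin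
          ι B                                              ≈⟨ *-identityˡ _ ⟨
          1# * ι B
            ≈⟨ *-cong (sym (root-^ ζᵏ≈1 (e ℕ.* l))) (ι-^ (N ℤ.* + k) l) ⟩
          (ζ ^ (e ℕ.* l)) ^ k * ι (N ℤ.* + k) ^ l
            ≡⟨ cong (λ j → (ζ ^ (e ℕ.* l)) ^ j * ι (N ℤ.* + k) ^ l) (≡.sym (ℕ.suc-pred k)) ⟩
          ζ ^ (e ℕ.* l) * v * ι (N ℤ.* + k) ^ l
            ≈⟨ solve 3 (λ z v n → z :* v :* n := v :* (z :* n)) refl (ζ ^ (e ℕ.* l)) v _ ⟩
          v * (ζ ^ (e ℕ.* l) * ι (N ℤ.* + k) ^ l)           ≈⟨ *-congˡ (*-congʳ (^-assocʳ ζ e l)) ⟨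
          v * ((ζ ^ e) ^ l * ι (N ℤ.* + k) ^ l)             ≈⟨ *-congˡ (^-distrib-* (ζ ^ e) _ l) ⟨
          v * (ζ ^ e * ι (N ℤ.* + k)) ^ l                   ≈⟨ *-congˡ (^-congˡ l derivative) ⟨
          v * (ζ * d g ζ * ev h ζ) ^ l
            ≈⟨ *-congˡ (^-distrib-* (ζ * d g ζ) (ev h ζ) l) ⟩
          v * ((ζ * d g ζ) ^ l * ev h ζ ^ l)
            ≈⟨ *-congˡ (*-congˡ (trans hˡ≈ (trans (+-congʳ hζˡ≈0) (+-identityˡ _)))) ⟩
          v * ((ζ * d g ζ) ^ l * (ι (+ l) * w))
            ≈⟨ solve 4 (λ v z l w → v :* (z :* (l :* w)) := l :* (v :* z :* w)) refl v
                ((ζ * d g ζ) ^ l) (ι (+ l)) w ⟩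
          ι (+ l) * (v * (ζ * d g ζ) ^ l * w)               ≈⟨ *-congˡ (proj₂ inℤ[ζ]) ⟩
          ι (+ l) * ev (proj₁ inℤ[ζ]) ζ                     ∎)
        where
        B = (N ℤ.* + k) ^ᶻ l
        -- The inverse of (ζ^e)^l, which removes the power of ζ left by the shift.
        v = (ζ ^ (e ℕ.* l)) ^ ℕ.pred k

        l∤B : ¬ (+ l ℤ.∣ B)
        l∤B = prime∤^ l-prime (N ℤ.* + k) l (prime∤* l-prime N (+ k) l∤N (l∤k ∘ ℤ.∣⇒∣ᵤ))

        inℤ[ζ] : ℤ[x] (v * (ζ * d g ζ) ^ l * w)
        inℤ[ζ] = ℤ[x]-* (ℤ[x]-* (ℤ[x]-^ (ℕ.pred k) (ℤ[x]-^ (e ℕ.* l) ℤ[x]-x))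
            (ℤ[x]-^ l (ℤ[x]-* ℤ[x]-x (d∈ℤ[ζ] g)))) (p , w≈)

        -- In the product rule g(ζ) = 0 removes one term on one side and ζ^k - 1 = 0 one term on the
        -- other; the factor ζ turns k ζ^(k-1) into k.
        derivative : ζ * d g ζ * ev h ζ ≈ ζ ^ e * ι (N ℤ.* + k)
        derivative = begin
          ζ * d g ζ * ev h ζ                       ≈⟨ *-assoc _ _ _ ⟩
          ζ * (d g ζ * ev h ζ)                     ≈⟨ *-congˡ (+-identityʳ _) ⟨
          ζ * (d g ζ * ev h ζ + 0#)
            ≈⟨ *-congˡ (+-congˡ (trans (*-congʳ gζ≈0) (zeroˡ _))) ⟨
          ζ * (d g ζ * ev h ζ + ev g ζ * d h ζ)    ≈⟨ *-congˡ (d-⊗ g h ζ) ⟨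
          ζ * d (g ⊗ h) ζ
            ≈⟨ *-congˡ (≃⇒d≈ (N · (X^ e ⊗ Xᵏ-1)) (g ⊗ h) (∥⇒≃ g∥f) ζ) ⟨
          ζ * d (N · (X^ e ⊗ Xᵏ-1)) ζ              ≈⟨ *-congˡ (d-· N (X^ e ⊗ Xᵏ-1) ζ) ⟩
          ζ * (ι N * d (X^ e ⊗ Xᵏ-1) ζ)            ≈⟨ *-congˡ (*-congˡ (d-⊗ (X^ e) Xᵏ-1 ζ)) ⟩
          ζ * (ι N * (d (X^ e) ζ * ev Xᵏ-1 ζ + ev (X^ e) ζ * d Xᵏ-1 ζ))
            ≈⟨ *-congˡ (*-congˡ (+-cong (trans (*-congˡ (ev-Xᵏ-1 ζᵏ≈1)) (zeroʳ _)) (*-congʳ (ev-X^ e ζ)))) ⟩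
          ζ * (ι N * (0# + ζ ^ e * d Xᵏ-1 ζ))      ≈⟨ *-congˡ (*-congˡ (+-identityˡ _)) ⟩
          ζ * (ι N * (ζ ^ e * d Xᵏ-1 ζ))
            ≈⟨ solve 4 (λ z n y f → z :* (n :* (y :* f)) := y :* (n :* (z :* f))) refl ζ (ι N)
                (ζ ^ e) (d Xᵏ-1 ζ) ⟩
          ζ ^ e * (ι N * (ζ * d Xᵏ-1 ζ))           ≈⟨ *-congˡ (*-congˡ (d-Xᵏ-1 ζᵏ≈1)) ⟩
          ζ ^ e * (ι N * ι (+ k))                  ≈⟨ *-congˡ (*-homo N (+ k)) ⟨
          ζ ^ e * ι (N ℤ.* + k)                    ∎

      conjugate-prime : ∀ p → ev p ζ ≈ 0# → ev p (ζ ^ l) ≈ 0#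
      conjugate-prime p pζ≈0 = [ (λ gζˡ≈0 → p-vanishes gζˡ≈0) ,
          (λ hζˡ≈0 → contradiction hζˡ≈0 (separable g∥f l∤scale gζ≈0)) ]′
        (domain _ _ (trans (sym (∥-ev g∥f (ζ ^ l))) (trans (*-congˡ (trans (*-congˡ (ev-Xᵏ-1 (root-^ ζᵏ≈1 l))) (zeroʳ _))) (zeroʳ _))))
        where
        G₀ = euclid ζ (root-cancel ζᵏ≈1) _ Xᵏ-1 p ℕ.≤-refl
        open Gcd G₀ renaming (gcd to g₀)
        open Reduced (reduce l-prime _ gcd∥ˡ gcd∥ʳ ℕ.≤-refl) renaming (g∥c to g∥p)

        gζ≈0 : ev g ζ ≈ 0#
        gζ≈0 = ι-cancel content≢0 (begin
          ι content * ev g ζ   ≈⟨ ev-· content g ζ ⟨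
          ev (content · g) ζ   ≈⟨ ≃⇒ev≈ g₀ (content · g) g₀≃ ζ ⟨
          ev g₀ ζ              ≈⟨ vanishes (ev-Xᵏ-1 ζᵏ≈1) pζ≈0 ⟩
          0#                   ∎)

        p-vanishes : ev g (ζ ^ l) ≈ 0# → ev p (ζ ^ l) ≈ 0#
        p-vanishes gζˡ≈0 = root-^-cancel (root-^ ζᵏ≈1 l) (_∥_.shift g∥p) _
          (ι-cancel (_∥_.scale≢0 g∥p) (trans (∥-ev g∥p (ζ ^ l)) (trans (*-congʳ gζˡ≈0) (zeroˡ _))))

    -- One prime at a time. Since ζ need only be a k-th root of unity, the induction can continue
    -- from ζ^l.
    conjugate-product : ∀ {ls} → All Prime ls → (∀ {l} → Prime l → l ℕ.∣ product ls → ¬ (l ℕ.∣ k)) →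
                        ∀ ζ → ζ ^ k ≈ 1# → ∀ p → ev p ζ ≈ 0# → ev p (ζ ^ product ls) ≈ 0#
    conjugate-product {[]} [] coprime ζ ζᵏ≈1 p pζ≈0 = trans (ev-cong p (*-identityʳ ζ)) pζ≈0
    conjugate-product {l ∷ ls} (l-prime ∷ ls-prime) coprime ζ ζᵏ≈1 p pζ≈0 =
      trans (ev-cong p (sym (^-assocʳ ζ l (product ls))))
        (conjugate-product ls-prime (λ q-prime q∣ → coprime q-prime (ℕ.∣n⇒∣m*n l q∣)) (ζ ^ l)
            (root-^ ζᵏ≈1 l) p
          (conjugate-prime l-prime (coprime l-prime (ℕ.m∣m*n (product ls))) ζ ζᵏ≈1 p pζ≈0))

-- Sums of roots of unity

open import Data.Nat using (_<_; _*_; _/_)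
open import Data.Nat.Divisibility using (_∣_)

module Butson {c ℓ} (R : CommutativeRing c ℓ) (domain : IsIntegralDomain R) (char0 : CharZero R) where
  open CommutativeRing R hiding (zero; _*_)
  open CommutativeRing R using () renaming (_*_ to infixl 7 _∙_)
  open CanonicalHom R
  open Evaluation R fromℤ-hom
  open Transfer R fromℤ-hom
  open Domain R domain char0
  open RootsOfUnity R domain char0
  open import Algebra.Properties.Semiring.Exp semiring using (_^_; ^-congˡ; ^-congʳ; ^-homo-*; ^-assocʳ)
  open import Algebra.Properties.CommutativeSemiring.Exp commutativeSemiring using (^-distrib-*)
  open import Algebra.Properties.Semiring.Mult semiring using (×1-homo-*) renaming (_×_ to _×ᴿ_)
  open import Algebra.Properties.Semiring.Sum semiring
    using (sum; *-distribˡ-sum; *-distribʳ-sum; sum-cong-≋; sum-replicate; sum-replicate-zero; ∑-comm)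
  open import Relation.Binary.Reasoning.Setoid setoid

  pow≡^ : ∀ x n → pow R x n ≡ x ^ n
  pow≡^ x zero    = ≡.refl
  pow≡^ x (suc n) = cong (x ∙_) (pow≡^ x n)

  sumFin≡sum : ∀ n (f : Fin n → Carrier) → sumFin R n f ≡ sum f
  sumFin≡sum zero    f = ≡.refl
  sumFin≡sum (suc n) f = cong (λ z → f zero + z) (sumFin≡sum n (f ∘ suc))

  sum-zero : ∀ {n} (f : Fin n → Carrier) → (∀ i → f i ≈ 0#) → sum f ≈ 0#
  sum-zero {n} f f≈0 = trans (sum-cong-≋ f≈0) (sum-replicate-zero n)

  sum-↑ : ∀ m n (f : Fin (m ℕ.+ n) → Carrier) → sum f ≈ sum (f ∘ (_↑ˡ n)) + sum (f ∘ (m ↑ʳ_))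
  sum-↑ zero    n f = sym (+-identityˡ _)
  sum-↑ (suc m) n f = trans (+-congˡ (sum-↑ m n (f ∘ suc))) (sym (+-assoc _ _ _))

  sum-combine : ∀ n p (f : Fin (n * p) → Carrier) → sum f ≈ sum {n} (λ i → sum {p} λ s → f (combine i s))
  sum-combine zero    p f = refl
  sum-combine (suc n) p f = trans (sum-↑ p (n * p) f) (+-congˡ (sum-combine n p (f ∘ (p ↑ʳ_))))

  geometric-suc : ∀ z n → sum {suc n} (λ t → z ^ toℕ t) ≈ 1# + z ∙ sum {n} (λ t → z ^ toℕ t)
  geometric-suc z n = +-congˡ (sym (*-distribˡ-sum {n} z (λ t → z ^ toℕ t)))

  -- Both sides are the sum of the first n + 1 powers, with the last or the first power split off.
  geometric-telescope : ∀ z n → sum {n} (λ t → z ^ toℕ t) + z ^ n ≈ 1# + z ∙ sum {n} (λ t → z ^ toℕ t)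
  geometric-telescope z zero    = trans (+-identityˡ _) (sym (trans (+-congˡ (zeroʳ z)) (+-identityʳ _)))
  geometric-telescope z (suc n) = begin
    sum {suc n} (λ t → z ^ toℕ t) + z ∙ z ^ n              ≈⟨ +-congʳ (geometric-suc z n) ⟩
    1# + z ∙ S + z ∙ z ^ n                                 ≈⟨ +-assoc _ _ _ ⟩
    1# + (z ∙ S + z ∙ z ^ n)                               ≈⟨ +-congˡ (distribˡ z S _) ⟨
    1# + z ∙ (S + z ^ n)
      ≈⟨ +-congˡ (*-congˡ (geometric-telescope z n)) ⟩
    1# + z ∙ (1# + z ∙ S)                                  ≈⟨ +-congˡ (*-congˡ (geometric-suc z n)) ⟨
    1# + z ∙ sum {suc n} (λ t → z ^ toℕ t)                 ∎
    where S = sum {n} (λ t → z ^ toℕ t)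

  -- Telescoping gives (z - 1) S = 0, and the domain property picks the case. This takes the place
  -- of deciding whether z is 1.
  ≈1⊎geometric≈0 : ∀ z n → z ^ n ≈ 1# → (z ≈ 1#) ⊎ (sum {n} (λ t → z ^ toℕ t) ≈ 0#)
  ≈1⊎geometric≈0 z n zⁿ≈1 = [ (λ eq → inj₁ (z≈1 eq)) , inj₂ ]′ (domain (z - 1#) S (begin
    (z - 1#) ∙ S                      ≈⟨ distribʳ S z (- 1#) ⟩
    z ∙ S + - 1# ∙ S
      ≈⟨ solve 4 (λ z S u w → z :* S :+ w :* S := (u :+ z :* S) :- (u :- w :* S)) refl z S 1# (- 1#) ⟩
    (1# + z ∙ S) - (1# - - 1# ∙ S)     ≈⟨ +-congʳ (geometric-telescope z n) ⟨
    (S + z ^ n) - (1# - - 1# ∙ S)      ≈⟨ +-congʳ (+-congˡ zⁿ≈1) ⟩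
    (S + 1#) - (1# - - 1# ∙ S)
      ≈⟨ solve 2 (λ S u → (S :+ u) :- (u :- (:- u) :* S) := S :- u :* S) refl S 1# ⟩
    S - 1# ∙ S                        ≈⟨ +-congˡ (-‿cong (*-identityˡ S)) ⟩
    S - S                            ≈⟨ -‿inverseʳ S ⟩
    0#                               ∎))
    where
    S = sum {n} (λ t → z ^ toℕ t)
    z≈1 : z - 1# ≈ 0# → z ≈ 1#
    z≈1 eq = begin
      z               ≈⟨ solve 2 (λ z u → z := (z :- u) :+ u) refl z 1# ⟩
      z - 1# + 1#     ≈⟨ +-congʳ eq ⟩
      0# + 1#         ≈⟨ +-identityˡ _ ⟩
      1#              ∎

  any⊎all : ∀ {n a b} {A : Fin n → Set a} {B : Fin n → Set b} → (∀ i → A i ⊎ B i) → ∃ A ⊎ (∀ i → B i)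
  any⊎all {zero}  f = inj₂ λ ()
  any⊎all {suc n} f with f zero | any⊎all (f ∘ suc)
  ... | inj₁ a | _            = inj₁ (zero , a)
  ... | inj₂ b | inj₁ (i , a) = inj₁ (suc i , a)
  ... | inj₂ b | inj₂ bs      = inj₂ λ { zero → b ; (suc i) → bs i }

  inverse-unique : ∀ {x y z} → x ∙ y ≈ 1# → x ∙ z ≈ 1# → y ≈ z
  inverse-unique {x} {y} {z} xy≈1 xz≈1 = begin
    y              ≈⟨ *-identityʳ y ⟨
    y ∙ 1#         ≈⟨ *-congˡ xz≈1 ⟨
    y ∙ (x ∙ z)    ≈⟨ *-assoc _ _ _ ⟨
    y ∙ x ∙ z      ≈⟨ *-congʳ (trans (*-comm y x) xy≈1) ⟩
    1# ∙ z         ≈⟨ *-identityˡ z ⟩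
    z              ∎

  ^-pred-inverse : ∀ {x} n .{{_ : ℕ.NonZero n}} → x ^ n ≈ 1# → x ∙ x ^ ℕ.pred n ≈ 1#
  ^-pred-inverse (suc n) eq = eq

  conjRoot≡^ : ∀ x n .{{_ : ℕ.NonZero n}} → conjRoot R n x ≡ x ^ ℕ.pred n
  conjRoot≡^ x (suc n) = pow≡^ x n

  ^-swap : ∀ y m n → (y ^ m) ^ n ≈ (y ^ n) ^ m
  ^-swap y m n = trans (^-assocʳ y m n)
      (trans (reflexive (cong (y ^_) (ℕ.*-comm m n))) (sym (^-assocʳ y n m)))

  module _ (k : ℕ) .{{k≢0 : ℕ.NonZero k}} (ζ : Carrier) (ζᵏ≈1 : ζ ^ k ≈ 1#)
           (ζ-primitive : ∀ d → 0 < d → d < k → ¬ (ζ ^ d ≈ 1#)) where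

    -- Raising a k-th root of unity to the power k - 1 inverts it, so exponents stay natural: a - a′
    -- is written a + a′ κ.
    κ : ℕ
    κ = ℕ.pred k

    ^≈1⇒k∣ : ∀ n → ζ ^ n ≈ 1# → k ∣ n
    ^≈1⇒k∣ n ζⁿ≈1 with n ℕ.% k in eq
    ... | zero  = ℕ.m%n≡0⇒n∣m n k eq
    ... | suc r = contradiction (trans (reflexive (cong (ζ ^_) (≡.sym eq))) (trans (sym (^-% k ζᵏ≈1 n)) ζⁿ≈1))
      (ζ-primitive (suc r) (s≤s z≤n) (≡.subst (_< k) eq (m%n<n n k)))

    -- If x differed from every power of ζ, the geometric sums of the k roots of unity
    -- x ζ^(-a) would all vanish, but they add up to k.
    root⇒power : ∀ x → x ^ k ≈ 1# → ∃ λ a → x ≈ ζ ^ a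
    root⇒power x xᵏ≈1 = [ isPower , (λ all≈0 → contradiction (k≈0 all≈0) k≉0) ]′
      (any⊎all λ a → ≈1⊎geometric≈0 (z a) k (zᵏ≈1 a))
      where
      -- This is the inverse of ζ.
      η = ζ ^ κ
      z : Fin k → Carrier
      z a = x ∙ η ^ toℕ a

      zᵏ≈1 : ∀ a → z a ^ k ≈ 1#
      zᵏ≈1 a = trans (^-distrib-* x _ k)
          (trans (*-cong xᵏ≈1 (root-^ k (root-^ k ζᵏ≈1 κ) (toℕ a))) (*-identityˡ _))

      ζη^≈1 : ∀ n → η ^ n ∙ ζ ^ n ≈ 1#
      ζη^≈1 n = trans (sym (^-distrib-* η ζ n))
          (trans (^-congˡ n (trans (*-comm η ζ) (^-pred-inverse k ζᵏ≈1))) (1^ n))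

      isPower : (∃ λ a → z a ≈ 1#) → ∃ λ a → x ≈ ζ ^ a
      isPower (a , za≈1) = toℕ a , (begin
        x                              ≈⟨ *-identityʳ x ⟨
        x ∙ 1#                         ≈⟨ *-congˡ (ζη^≈1 (toℕ a)) ⟨
        x ∙ (η ^ toℕ a ∙ ζ ^ toℕ a)    ≈⟨ *-assoc _ _ _ ⟨
        z a ∙ ζ ^ toℕ a                ≈⟨ *-congʳ za≈1 ⟩
        1# ∙ ζ ^ toℕ a                 ≈⟨ *-identityˡ _ ⟩
        ζ ^ toℕ a                      ∎)

      k≉0 : ¬ (k ×ᴿ 1# ≈ 0#)
      k≉0 eq = ℕ.≢-nonZero⁻¹ k (ℤ.+-injective (ι≈0⇒≡0 (+ k) eq))

      column : ℕ → Carrier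
      column j = sum {k} λ a → z a ^ j

      column-0 : column 0 ≈ k ×ᴿ 1#
      column-0 = sum-replicate k

      -- The sum is x^j times a geometric sum of ratio ζ^(-j), which is not 1 because ζ is
      -- primitive.
      column-≢0 : ∀ j → 0 < j → j < k → column j ≈ 0#
      column-≢0 j 0<j j<k = begin
        sum {k} (λ a → z a ^ j)
          ≈⟨ sum-cong-≋ {k} (λ a → trans (^-distrib-* x _ j) (*-congˡ (^-swap η (toℕ a) j))) ⟩
        sum {k} (λ a → x ^ j ∙ (η ^ j) ^ toℕ a)      ≈⟨ *-distribˡ-sum {k} (x ^ j) _ ⟨
        x ^ j ∙ sum {k} (λ a → (η ^ j) ^ toℕ a)      ≈⟨ *-congˡ ([ (λ ηʲ≈1 → contradiction (begin
            ζ ^ j          ≈⟨ *-identityˡ _ ⟨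
            1# ∙ ζ ^ j     ≈⟨ *-congʳ ηʲ≈1 ⟨
            η ^ j ∙ ζ ^ j  ≈⟨ ζη^≈1 j ⟩
            1#             ∎) (ζ-primitive j 0<j j<k)) , (λ S≈0 → S≈0) ]′
            (≈1⊎geometric≈0 (η ^ j) k (root-^ k (root-^ k ζᵏ≈1 κ) j))) ⟩
        x ^ j ∙ 0#                                   ≈⟨ zeroʳ _ ⟩
        0#                                           ∎

      -- The number of columns is kept apart from `k` so that it can be matched as a successor and
      -- column 0 split off.
      columns : ∀ m → m ℕ.≤ k → 0 < m → sum {m} (λ j → column (toℕ j)) ≈ k ×ᴿ 1#
      columns (suc m) m<k _ = trans (+-cong column-0 (sum-zero {m} _ λ j →
        column-≢0 (toℕ (suc j)) (s≤s z≤n) (ℕ.≤-trans (s≤s (Fin.toℕ<n j)) m<k))) (+-identityʳ _)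

      k≈0 : (∀ a → sum {k} (λ j → z a ^ toℕ j) ≈ 0#) → k ×ᴿ 1# ≈ 0#
      k≈0 all≈0 = begin
        k ×ᴿ 1#                                      ≈⟨ columns k ℕ.≤-refl (ℕ.>-nonZero⁻¹ k) ⟨
        sum {k} (λ j → sum {k} λ a → z a ^ toℕ j)    ≈⟨ ∑-comm {k} {k} (λ j a → z a ^ toℕ j) ⟩
        sum {k} (λ a → sum {k} λ j → z a ^ toℕ j)    ≈⟨ sum-zero {k} _ all≈0 ⟩
        0#                                           ∎

    monomials : ∀ {n} → (Fin n → ℕ) → Poly
    monomials {zero}  e = []
    monomials {suc n} e = X^ (e zero) ⊕ monomials (e ∘ suc)

    ev-monomials : ∀ {n} (e : Fin n → ℕ) y → ev (monomials e) y ≈ sum λ j → y ^ e j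
    ev-monomials {zero}  e y = refl
    ev-monomials {suc n} e y = trans (ev-⊕ (X^ (e zero)) _ y)
        (+-cong (ev-X^ (e zero) y) (ev-monomials (e ∘ suc) y))

    -- The polynomial Σ x^(e j) - b has the zero ζ; conjugation along the prime factors of `u` gives
    -- it the zero ζ^u.
    conjugate-sum : ∀ u .{{_ : ℕ.NonZero u}} → (∀ {l} → Prime l → l ∣ u → ¬ (l ∣ k)) →
                    ∀ {n} (e : Fin n → ℕ) b → sum (λ j → ζ ^ e j) ≈ ι b → sum (λ j → (ζ ^ u) ^ e j) ≈ ι b
    conjugate-sum u coprime e b eq = begin
      sum (λ j → (ζ ^ u) ^ e j)              ≈⟨ ev-monomials e (ζ ^ u) ⟨
      ev (monomials e) (ζ ^ u)
        ≈⟨ solve 2 (λ s b → s := (s :- b) :+ b) refl _ (ι b) ⟩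
      ev (monomials e) (ζ ^ u) - ι b + ι b   ≈⟨ +-congʳ (ev-P (ζ ^ u)) ⟨
      ev P (ζ ^ u) + ι b
        ≈⟨ +-congʳ (≡.subst (λ u → ev P (ζ ^ u) ≈ 0#) (≡.sym isFactorisation)
                                                  (conjugate-product k factorsPrime
                                                    (λ l-prime l∣ → coprime l-prime
                                                        (≡.subst (_ ∣_) (≡.sym isFactorisation) l∣))
                                                    ζ ζᵏ≈1 P Pζ≈0)) ⟩
      0# + ι b                               ≈⟨ +-identityˡ _ ⟩
      ι b                                    ∎
      where
      open PrimeFactorisation (factorise u)
      P = monomials e ⊕ (ℤ.- b ∷ [])
      ev-P : ∀ y → ev P y ≈ ev (monomials e) y - ι b
      ev-P y = trans (ev-⊕ (monomials e) _ y)
          (+-congˡ (trans (+-congˡ (zeroʳ y)) (trans (+-identityʳ _) (-‿homo b))))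
      Pζ≈0 : ev P ζ ≈ 0#
      Pζ≈0 = begin
        ev P ζ                      ≈⟨ ev-P ζ ⟩
        ev (monomials e) ζ - ι b    ≈⟨ +-congʳ (trans (ev-monomials e ζ) eq) ⟩
        ι b - ι b                   ≈⟨ -‿inverseʳ _ ⟩
        0#                          ∎

    1+κ≡k : suc κ ≡ k
    1+κ≡k = ℕ.suc-pred k

    -- Exponents of the new entries

    module _ (p q : ℕ) .{{_ : ℕ.NonZero p}} (k≡ : k ≡ q * p * p) where

      m : ℕ
      m = q * p

      p∣k : p ∣ k
      p∣k = ℕ.divides m k≡

      -- The conjugate ζ ^ (u t) is ζ times the t-th power of the p-th root of unity ζ ^ m.
      u : ℕ → ℕ
      u t = suc (m * t)

      -- Here p² | k enters: p divides m, so a prime dividing k = m p divides m already, and with 1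
      -- + m t it would divide 1.
      u-coprime : ∀ t {l} → Prime l → l ∣ u t → ¬ (l ∣ k)
      u-coprime t {l} l-prime l∣u l∣k = ℕ.nonTrivial⇒≢1 {{prime⇒nonTrivial l-prime}}
        (ℕ.∣1⇒≡1 (ℕ.∣m+n∣m⇒∣n (≡.subst (l ∣_) (≡.sym (ℕ.+-comm (m * t) 1)) l∣u) (ℕ.∣m⇒∣m*n t l∣m)))
        where
        l∣m : l ∣ m
        l∣m = [ (λ l∣m → l∣m) , (λ l∣p → ℕ.∣n⇒∣m*n q l∣p) ]′
            (euclidsLemma m p l-prime (≡.subst (l ∣_) k≡ l∣k))

      -- With D standing for A - A′ modulo k, the sum is ζ^D times a geometric sum whose ratio ζ^(m
      -- D) is a p-th root of unity; that ratio is 1 only if p divides A - A′.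
      sum-u≈0 : ∀ A A′ → A ℕ.% p ≢ A′ ℕ.% p → sum {p} (λ t → (ζ ^ u (toℕ t)) ^ (A ℕ.+ A′ * κ)) ≈ 0#
      sum-u≈0 A A′ A≢A′ = begin
        sum {p} (λ t → (ζ ^ u (toℕ t)) ^ D)             ≈⟨ sum-cong-≋ {p} (λ t → split (toℕ t)) ⟩
        sum {p} (λ t → ζ ^ D ∙ (ζ ^ (m * D)) ^ toℕ t)   ≈⟨ *-distribˡ-sum {p} (ζ ^ D) _ ⟨
        ζ ^ D ∙ sum {p} (λ t → (ζ ^ (m * D)) ^ toℕ t)
          ≈⟨ *-congˡ ([ (λ eq → contradiction (A≡A′ (^≈1⇒k∣ (m * D) eq)) A≢A′) , (λ S≈0 → S≈0) ]′
               (≈1⊎geometric≈0 (ζ ^ (m * D)) p ωᵖ≈1)) ⟩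
        ζ ^ D ∙ 0#                                     ≈⟨ zeroʳ _ ⟩
        0#                                             ∎
        where
        D = A ℕ.+ A′ * κ

        split : ∀ t → (ζ ^ u t) ^ D ≈ ζ ^ D ∙ (ζ ^ (m * D)) ^ t
        split t = begin
          (ζ ^ u t) ^ D                ≈⟨ ^-assocʳ ζ (u t) D ⟩
          ζ ^ (u t * D)                ≈⟨ ^-congʳ ζ (expo m t D) ⟩
          ζ ^ (D ℕ.+ m * D * t)        ≈⟨ ^-homo-* ζ D (m * D * t) ⟩
          ζ ^ D ∙ ζ ^ (m * D * t)      ≈⟨ *-congˡ (^-assocʳ ζ (m * D) t) ⟨
          ζ ^ D ∙ (ζ ^ (m * D)) ^ t    ∎
          where
          expo : ∀ m t D → suc (m * t) * D ≡ D ℕ.+ m * D * t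
          expo = solve-∀

        ωᵖ≈1 : (ζ ^ (m * D)) ^ p ≈ 1#
        ωᵖ≈1 = trans (^-assocʳ ζ (m * D) p)
            (trans (^-congʳ ζ (≡.trans (expo m D p) (cong (D *_) (≡.sym k≡)))) (^-*-1 k ζᵏ≈1 D))
          where
          expo : ∀ m D p → m * D * p ≡ D * (m * p)
          expo = solve-∀

        -- Cancelling m from k = m p gives p | D, and D + A′ = A + A′ k is congruent to A modulo p.
        A≡A′ : k ∣ m * D → A ℕ.% p ≡ A′ ℕ.% p
        A≡A′ k∣mD = ≡.trans (≡.sym (%-remove-+ʳ A (ℕ.∣n⇒∣m*n A′ p∣k)))
          (≡.trans (cong (ℕ._% p) A+A′k≡) (%-remove-+ˡ A′ p∣D))
          where
          m≢0 : ℕ.NonZero m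
          m≢0 = ℕ.≢-nonZero λ m≡0 → ℕ.≢-nonZero⁻¹ k (≡.trans k≡ (cong (_* p) m≡0))
          p∣D : p ∣ D
          p∣D = ℕ.*-cancelˡ-∣ m {{m≢0}} (≡.subst (_∣ m * D) k≡ k∣mD)
          A+A′k≡ : A ℕ.+ A′ * k ≡ D ℕ.+ A′
          A+A′k≡ = ≡.trans (cong (λ k → A ℕ.+ A′ * k) (≡.sym 1+κ≡k)) (expo A A′ κ)
            where
            expo : ∀ A A′ κ → A ℕ.+ A′ * suc κ ≡ A ℕ.+ A′ * κ ℕ.+ A′
            expo = solve-∀

      E : ℕ → ℕ → ℕ
      E A t = A ℕ./ p * p ℕ.+ m * t * A

      E+% : ∀ A t → E A t ℕ.+ A ℕ.% p ≡ u t * A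
      E+% A t = ≡.trans (expo (A ℕ./ p * p) (m * t * A) (A ℕ.% p))
          (cong (ℕ._+ m * t * A) (≡.sym (m≡m%n+[m/n]*n A p)))
        where
        expo : ∀ a b c → a ℕ.+ b ℕ.+ c ≡ c ℕ.+ a ℕ.+ b
        expo = solve-∀

      -- Both terms of `E A t` are multiples of p, as p divides m, and p m = k.
      E*m : ∀ A t → E A t * m ≡ (A ℕ./ p ℕ.+ t * A * q) * k
      E*m A t = ≡.trans (expo (A ℕ./ p) p q t A) (cong ((A ℕ./ p ℕ.+ t * A * q) *_) (≡.sym k≡))
        where
        expo : ∀ a p q t A → (a * p ℕ.+ q * p * t * A) * (q * p) ≡ (a ℕ.+ t * A * q) * (q * p * p)
        expo = solve-∀

      -- The factors ζ^(A mod p) and ζ^(A′ mod p) left out by `E` do not depend on t, so one common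
      -- factor restores them throughout the sum.
      times-ρ : ∀ A A′ → sum {p} (λ t → ζ ^ E A (toℕ t) ∙ (ζ ^ E A′ (toℕ t)) ^ κ)
                           ∙ ζ ^ (A ℕ.% p ℕ.+ A′ ℕ.% p * κ) ≈
                         sum {p} (λ t → (ζ ^ u (toℕ t)) ^ (A ℕ.+ A′ * κ))
      times-ρ A A′ = trans (*-distribʳ-sum {p} _ _) (sum-cong-≋ {p} (λ t → begin
          ζ ^ E A (toℕ t) ∙ (ζ ^ E A′ (toℕ t)) ^ κ ∙ ζ ^ (r ℕ.+ r′ * κ)
            ≈⟨ *-cong (*-congˡ (^-assocʳ ζ (E A′ (toℕ t)) κ)) refl ⟩
          ζ ^ E A (toℕ t) ∙ ζ ^ (E A′ (toℕ t) * κ) ∙ ζ ^ (r ℕ.+ r′ * κ)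
            ≈⟨ *-congʳ (^-homo-* ζ (E A (toℕ t)) _) ⟨
          ζ ^ (E A (toℕ t) ℕ.+ E A′ (toℕ t) * κ) ∙ ζ ^ (r ℕ.+ r′ * κ)
            ≈⟨ ^-homo-* ζ (E A (toℕ t) ℕ.+ E A′ (toℕ t) * κ) _ ⟨
          ζ ^ (E A (toℕ t) ℕ.+ E A′ (toℕ t) * κ ℕ.+ (r ℕ.+ r′ * κ))
            ≈⟨ ^-congʳ ζ (≡.trans (expo (E A (toℕ t)) (E A′ (toℕ t)) r r′ κ)
                 (≡.trans (cong₂ (λ a b → a ℕ.+ b * κ) (E+% A (toℕ t)) (E+% A′ (toℕ t)))
                     (expo′ (u (toℕ t)) A A′ κ))) ⟩
          ζ ^ (u (toℕ t) * (A ℕ.+ A′ * κ))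
            ≈⟨ ^-assocʳ ζ (u (toℕ t)) (A ℕ.+ A′ * κ) ⟨
          (ζ ^ u (toℕ t)) ^ (A ℕ.+ A′ * κ) ∎))
        where
        r  = A ℕ.% p
        r′ = A′ ℕ.% p
        expo : ∀ a b r s κ → a ℕ.+ b * κ ℕ.+ (r ℕ.+ s * κ) ≡ (a ℕ.+ r) ℕ.+ (b ℕ.+ s) * κ
        expo = solve-∀
        expo′ : ∀ u A B κ → u * A ℕ.+ u * B * κ ≡ u * (A ℕ.+ B * κ)
        expo′ = solve-∀

      -- Both sides differ by the factor ζ ^ (A % p - A′ % p); unless it is 1, both sums vanish.
      sum-E : ∀ A A′ → sum {p} (λ t → ζ ^ E A (toℕ t) ∙ (ζ ^ E A′ (toℕ t)) ^ κ) ≈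
                       sum {p} (λ t → (ζ ^ u (toℕ t)) ^ (A ℕ.+ A′ * κ))
      sum-E A A′ with A ℕ.% p ℕ.≟ A′ ℕ.% p
      ... | no r≢r′ = trans
        (root-^-cancel k ζᵏ≈1 ρ _ (trans (*-comm _ _) (trans (times-ρ A A′) (sum-u≈0 A A′ r≢r′))))
        (sym (sum-u≈0 A A′ r≢r′))
        where ρ = A ℕ.% p ℕ.+ A′ ℕ.% p * κ
      ... | yes r≡r′ = begin
        S                                            ≈⟨ *-identityʳ S ⟨
        S ∙ 1#                                       ≈⟨ *-congˡ ρ≈1 ⟨
        S ∙ ζ ^ (A ℕ.% p ℕ.+ A′ ℕ.% p * κ)           ≈⟨ times-ρ A A′ ⟩
        sum {p} (λ t → (ζ ^ u (toℕ t)) ^ (A ℕ.+ A′ * κ)) ∎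
        where
        S = sum {p} (λ t → ζ ^ E A (toℕ t) ∙ (ζ ^ E A′ (toℕ t)) ^ κ)
        ρ≈1 : ζ ^ (A ℕ.% p ℕ.+ A′ ℕ.% p * κ) ≈ 1#
        ρ≈1 = trans (^-congʳ ζ (≡.trans (cong (ℕ._+ A′ ℕ.% p * κ) r≡r′)
          (≡.trans (≡.sym (ℕ.*-suc (A′ ℕ.% p) κ)) (cong (A′ ℕ.% p *_) 1+κ≡k)))) (^-*-1 k ζᵏ≈1 (A′ ℕ.% p))

      -- The new matrix and its row products

      module _ (n : ℕ) (H : Fin n → Fin n → Carrier) (H-BH : IsBH R n k H) where

        exponent : Fin n → Fin n → ℕ
        exponent i j = proj₁ (root⇒power (H i j) (trans (reflexive (≡.sym (pow≡^ (H i j) k))) (proj₁ H-BH i j)))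

        H≈ : ∀ i j → H i j ≈ ζ ^ exponent i j
        H≈ i j = proj₂ (root⇒power (H i j) (trans (reflexive (≡.sym (pow≡^ (H i j) k))) (proj₁ H-BH i j)))

        -- Integer values, because these are what `conjugate-sum` carries over to conjugates.
        scaledIdℤ : Fin n → Fin n → ℤ
        scaledIdℤ i i′ with i Fin.≟ i′
        ... | yes _ = + n
        ... | no  _ = 0ℤ

        scaledId≈ι : ∀ i i′ → scaledId R n i i′ ≈ ι (scaledIdℤ i i′)
        scaledId≈ι i i′ with i Fin.≟ i′
        ... | yes _ = reflexive (natR≡× n)
        ... | no  _ = refl

        difference : Fin n → Fin n → Fin n → ℕ
        difference i i′ j = exponent i j ℕ.+ exponent i′ j * κ

        orthogonal : ∀ i i′ → sum (λ j → ζ ^ difference i i′ j) ≈ ι (scaledIdℤ i i′)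
        orthogonal i i′ = begin
          sum (λ j → ζ ^ difference i i′ j)
            ≈⟨ sum-cong-≋ {n} (λ j → trans (^-homo-* ζ (exponent i j) _) (*-congˡ (sym (^-assocʳ ζ (exponent i′ j) κ)))) ⟩
          sum (λ j → ζ ^ exponent i j ∙ (ζ ^ exponent i′ j) ^ κ)
            ≈⟨ sum-cong-≋ {n} (λ j → *-cong (sym (H≈ i j)) (trans (^-congˡ κ (sym (H≈ i′ j)))
                 (reflexive (≡.sym (conjRoot≡^ (H i′ j) k))))) ⟩
          sum (λ j → H i j ∙ conjRoot R k (H i′ j))
            ≡⟨ sumFin≡sum n _ ⟨
          sumFin R n (λ j → H i j ∙ conjRoot R k (H i′ j))
            ≈⟨ proj₂ H-BH i i′ ⟩
          scaledId R n i i′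
            ≈⟨ scaledId≈ι i i′ ⟩
          ι (scaledIdℤ i i′) ∎

        entry : Fin n × Fin p → Fin n × Fin p → Carrier
        entry (i , s) (j , t) = ζ ^ E (exponent i j ℕ.+ toℕ s) (toℕ t)

        H′ : Fin (n * p) → Fin (n * p) → Carrier
        H′ I J = entry (remQuot {n} p I) (remQuot {n} p J)

        entry-root : ∀ I J → entry I J ^ m ≈ 1#
        entry-root (i , s) (j , t) = trans (^-assocʳ ζ (E A (toℕ t)) m)
          (trans (^-congʳ ζ (E*m A (toℕ t))) (^-*-1 k ζᵏ≈1 (A ℕ./ p ℕ.+ toℕ t * A * q)))
          where A = exponent i j ℕ.+ toℕ s

        instance
          m≢0 : ℕ.NonZero m
          m≢0 = ℕ.≢-nonZero λ m≡0 → ℕ.≢-nonZero⁻¹ k (≡.trans k≡ (cong (_* p) m≡0))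

        -- The powers m - 1 and k - 1 of an entry are both its inverse, since its order divides m as
        -- well as k.
        conj-entry : ∀ I J → conjRoot R m (entry I J) ≈ entry I J ^ κ
        conj-entry I@(i , s) J@(j , t) = trans (reflexive (conjRoot≡^ (entry I J) m)) (inverse-unique
          (^-pred-inverse m (entry-root I J))
          (^-pred-inverse k (root-^ k ζᵏ≈1 (E (exponent i j ℕ.+ toℕ s) (toℕ t)))))

        -- After `sum-E` the exponent splits into a part from s, s′ and a part from H. The sum over
        -- j of the latter is a conjugated row product of H, the same integer for every t, so the
        -- Gram matrix factors as a Kronecker product.
        inner : ∀ i s i′ s′ →
                sum {n} (λ j → sum {p} λ t → entry (i , s) (j , t) ∙ entry (i′ , s′) (j , t) ^ κ) ≈
                sum {p} (λ t → (ζ ^ u (toℕ t)) ^ (toℕ s ℕ.+ toℕ s′ * κ)) ∙ ι (scaledIdℤ i i′)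
        inner i s i′ s′ = begin
          sum {n} (λ j → sum {p} λ t → entry (i , s) (j , t) ∙ entry (i′ , s′) (j , t) ^ κ)
            ≈⟨ sum-cong-≋ {n} (λ j → sum-E (exponent i j ℕ.+ toℕ s) (exponent i′ j ℕ.+ toℕ s′)) ⟩
          sum {n} (λ j → sum {p} λ t → (ζ ^ u (toℕ t)) ^ (exponent i j ℕ.+ toℕ s ℕ.+ (exponent i′ j ℕ.+ toℕ s′) * κ))
            ≈⟨ ∑-comm {n} {p} _ ⟩
          sum {p} (λ t → sum {n} λ j → (ζ ^ u (toℕ t)) ^ (exponent i j ℕ.+ toℕ s ℕ.+ (exponent i′ j ℕ.+ toℕ s′) * κ))
            ≈⟨ sum-cong-≋ {p} (λ t → sum-cong-≋ {n} (λ j →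
                 trans (^-congʳ _ (expo (exponent i j) (toℕ s) (exponent i′ j) (toℕ s′) κ))
                     (^-homo-* _ σ _))) ⟩
          sum {p} (λ t → sum {n} λ j → (ζ ^ u (toℕ t)) ^ σ ∙ (ζ ^ u (toℕ t)) ^ difference i i′ j)
            ≈⟨ sum-cong-≋ {p} (λ t → sym (*-distribˡ-sum {n} ((ζ ^ u (toℕ t)) ^ σ) _)) ⟩
          sum {p} (λ t → (ζ ^ u (toℕ t)) ^ σ ∙ sum {n} λ j → (ζ ^ u (toℕ t)) ^ difference i i′ j)
            ≈⟨ sum-cong-≋ {p} (λ t → *-congˡ (conjugate-sum (u (toℕ t)) (u-coprime (toℕ t)) (difference i i′) (scaledIdℤ i i′) (orthogonal i i′))) ⟩
          sum {p} (λ t → (ζ ^ u (toℕ t)) ^ σ ∙ ι (scaledIdℤ i i′))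
            ≈⟨ *-distribʳ-sum {p} (ι (scaledIdℤ i i′)) _ ⟨
          sum {p} (λ t → (ζ ^ u (toℕ t)) ^ σ) ∙ ι (scaledIdℤ i i′) ∎
          where
          σ = toℕ s ℕ.+ toℕ s′ * κ
          expo : ∀ a s b r κ → a ℕ.+ s ℕ.+ (b ℕ.+ r) * κ ≡ s ℕ.+ r * κ ℕ.+ (a ℕ.+ b * κ)
          expo = solve-∀

        inner-diagonal : ∀ i s → sum {p} (λ t → (ζ ^ u (toℕ t)) ^ (toℕ {p} s ℕ.+ toℕ s * κ))
                           ∙ ι (scaledIdℤ i i) ≈ (n * p) ×ᴿ 1#
        inner-diagonal i s with i Fin.≟ i
        ... | no i≢i = contradiction ≡.refl i≢i
        ... | yes _  = begin
          sum {p} (λ t → (ζ ^ u (toℕ t)) ^ (toℕ s ℕ.+ toℕ s * κ)) ∙ n ×ᴿ 1#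
            ≈⟨ *-congʳ (sum-cong-≋ {p} (λ t → trans (^-congʳ _ s+sκ≡) (^-*-1 k (root-^ k ζᵏ≈1 (u (toℕ t))) (toℕ s)))) ⟩
          sum {p} (λ t → 1#) ∙ n ×ᴿ 1#
            ≈⟨ *-congʳ (sum-replicate p) ⟩
          p ×ᴿ 1# ∙ n ×ᴿ 1#
            ≈⟨ *-comm _ _ ⟩
          n ×ᴿ 1# ∙ p ×ᴿ 1#
            ≈⟨ ×1-homo-* n p ⟨
          (n * p) ×ᴿ 1# ∎
          where
          s+sκ≡ : toℕ s ℕ.+ toℕ s * κ ≡ toℕ s * k
          s+sκ≡ = ≡.trans (≡.sym (ℕ.*-suc (toℕ s) κ)) (cong (toℕ s *_) 1+κ≡k)

        -- For i ≠ i′ the factor from H is 0. Otherwise s ≠ s′, and both are below p, so they differ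
        -- modulo p and the sum over t is 0.
        inner-off-diagonal : ∀ i s i′ s′ → ¬ ((i , s) ≡ (i′ , s′)) →
          sum {p} (λ t → (ζ ^ u (toℕ t)) ^ (toℕ {p} s ℕ.+ toℕ {p} s′ * κ)) ∙ ι (scaledIdℤ i i′) ≈ 0#
        inner-off-diagonal i s i′ s′ ≢ with i Fin.≟ i′
        ... | no  _      = zeroʳ _
        ... | yes ≡.refl = trans (*-congʳ (sum-u≈0 (toℕ s) (toℕ s′) λ eq → ≢ (cong (i ,_) (Fin.toℕ-injective
          (≡.trans (≡.sym (m<n⇒m%n≡m (Fin.toℕ<n s))) (≡.trans eq (m<n⇒m%n≡m (Fin.toℕ<n s′))))))))
              (zeroˡ _)

        H′-orthogonal : ∀ I I′ → sumFin R (n * p)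
            (λ J → H′ I J ∙ conjRoot R m (H′ I′ J)) ≈ scaledId R (n * p) I I′
        H′-orthogonal I I′ = begin
          sumFin R (n * p) (λ J → H′ I J ∙ conjRoot R m (H′ I′ J))
            ≡⟨ sumFin≡sum (n * p) _ ⟩
          sum {n * p} (λ J → H′ I J ∙ conjRoot R m (H′ I′ J))
            ≈⟨ sum-cong-≋ {n * p} (λ J → *-congˡ (conj-entry (remQuot {n} p I′) (remQuot {n} p J))) ⟩
          sum {n * p} (λ J → H′ I J ∙ H′ I′ J ^ κ)
            ≈⟨ sum-combine n p _ ⟩
          sum {n} (λ j → sum {p} λ t → H′ I (combine j t) ∙ H′ I′ (combine j t) ^ κ)
            ≈⟨ sum-cong-≋ {n} (λ j → sum-cong-≋ {p} (λ t → reflexive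
                 (cong (λ J → entry (remQuot {n} p I) J ∙ entry (remQuot {n} p I′) J ^ κ)
                     (Fin.remQuot-combine j t)))) ⟩
          sum {n} (λ j → sum {p} λ t → entry (remQuot {n} p I) (j , t) ∙ entry (remQuot {n} p I′) (j , t) ^ κ)
            ≈⟨ inner (proj₁ (remQuot {n} p I)) (proj₂ (remQuot {n} p I)) (proj₁ (remQuot {n} p I′))
                (proj₂ (remQuot {n} p I′)) ⟩
          sum {p} (λ t → (ζ ^ u (toℕ t)) ^ (toℕ (proj₂ (remQuot {n} p I)) ℕ.+ toℕ (proj₂ (remQuot {n} p I′)) * κ))
              ∙ ι (scaledIdℤ (proj₁ (remQuot {n} p I)) (proj₁ (remQuot {n} p I′)))
            ≈⟨ rhs ⟩
          scaledId R (n * p) I I′ ∎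
          where
          rhs : sum {p} (λ t → (ζ ^ u (toℕ t)) ^ (toℕ (proj₂ (remQuot {n} p I)) ℕ.+ toℕ (proj₂ (remQuot {n} p I′)) * κ))
                  ∙ ι (scaledIdℤ (proj₁ (remQuot {n} p I)) (proj₁ (remQuot {n} p I′)))
                  ≈ scaledId R (n * p) I I′
          rhs with I Fin.≟ I′
          ... | yes ≡.refl = trans (inner-diagonal (proj₁ (remQuot {n} p I)) (proj₂ (remQuot {n} p I))) (reflexive (≡.sym (natR≡× (n * p))))
          ... | no  I≢I′   = inner-off-diagonal _ _ _ _ λ eq → I≢I′
            (≡.trans (≡.sym (Fin.combine-remQuot {n} p I))
                (≡.trans (cong (λ is → combine (proj₁ is) (proj₂ is)) eq)
                    (Fin.combine-remQuot {n} p I′)))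

        H′-BH : IsBH R (n * p) m H′
        H′-BH = (λ I J → trans (reflexive (pow≡^ (H′ I J) m))
            (entry-root (remQuot {n} p I) (remQuot {n} p J))) , H′-orthogonal

theorem1p1 : ∀ {c ℓ : Level} (R : CommutativeRing c ℓ) →
    IsIntegralDomain R → CharZero R →
    (n k p : ℕ) → 0 < n → 0 < k → (pp : Prime p) → p * p ∣ k →
    (ζ : CommutativeRing.Carrier R) → IsPrimitiveRoot R k ζ →
    BHExists R n k →
    BHExists R (n * p) (_/_ k p {{prime⇒nonZero pp}})
theorem1p1 R domain char0 n k p 0<n 0<k pp (ℕ.divides q k≡) ζ (powᵏ≈1 , pow-primitive) (H , H-BH) =
  ≡.subst (BHExists R (n * p)) (≡.sym k/p≡)
    (H′ k ζ ζᵏ≈1 ζ-primitive p q k≡′ n H H-BH , H′-BH k ζ ζᵏ≈1 ζ-primitive p q k≡′ n H H-BH)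
  where
  open CommutativeRing R using (_≈_; 1#; trans; reflexive)
  open Butson R domain char0
  instance
    _ = prime⇒nonZero pp
    _ = ℕ.>-nonZero 0<k
  k≡′ : k ≡ q * p * p
  k≡′ = ≡.trans k≡ (≡.sym (ℕ.*-assoc q p p))
  k/p≡ : k / p ≡ q * p
  k/p≡ = ≡.trans (cong (_/ p) k≡′) (m*n/n≡m (q * p) p)
  ζᵏ≈1 = trans (reflexive (≡.sym (pow≡^ ζ k))) powᵏ≈1
  ζ-primitive = λ d 0<d d<k ζᵈ≈1 → pow-primitive d 0<d d<k (trans (reflexive (pow≡^ ζ d)) ζᵈ≈1)
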